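{- Let $0<L<U$ and $\gamma=U/L$. Consider the online knapsack problem with infinitesimal item weights and with value densities in $[L,U]$. For every $\alpha>0$, the degradation factor of the threshold algorithm $\mathrm{OKP\text{ - }Alg}(\alpha)$ with respect to $\mathrm{OKP\text{ - }Alg}(1)$ is $$\mathrm{DF}(\mathrm{OKP\text{ - }Alg}(\alpha))=\begin{cases}\dfrac{\alpha\gamma}{\alpha+\gamma-1}, & \alpha\in[1,+\infty),\\[2mm] \dfrac{\alpha\gamma}{\alpha+\gamma^{\alpha}-1}, & \alpha\in(0,1),\end{cases}$$ that is, $\mathrm{CR}(\mathrm{OKP\text{ - }Alg}(\alpha))=\mathrm{DF}(\mathrm{OKP\text{ - }Alg}(\alpha))\cdot\mathrm{CR}(\mathrm{OKP\text{ - }Alg}(1))$ with $\mathrm{DF}$ given by this formula.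
   Context: Online knapsack problem: items $i=1,\dots,n$ with values $v_i>0$ and weights $w_i>0$ arrive one by one ($n$ is unknown). On arrival of item $i$ the algorithm irrevocably chooses $x_i\in\{0,1\}$ (admit or reject) knowing only $(v_j,w_j)_{j\le i}$ and its past decisions. The constraint is $\sum_i w_ix_i\le 1$ and the goal is to maximize $\sum_i v_ix_i$. Standing assumptions: (1) $w_i\ll 1$ for all $i$ (infinitesimal weights); (2) $L\le v_i/w_i\le U$ for all $i$. Threshold function: with $T=1/(\ln\gamma+1)$, $$\Psi_\alpha(z)=\begin{cases}L, & z\in[0,T),\\ \min\{U,\,Le^{\alpha(z/T-1)}\}, & z\in[T,1),\\ +\infty, & z=1.\end{cases}$$ $\mathrm{OKP\text{ - }Alg}(\alpha)$: start with utilization $z_0=0$. On arrival of item $i$, choose $x_i^*\in\{0,1\}$ maximizing $v_ix_i-\Psi_\alpha(z_{i-1})w_ix_i$, i.e. admit item $i$ iff $v_i/w_i\ge\Psi_\alpha(z_{i-1})$ (and the item fits in the remaining capacity). Then set $z_i=z_{i-1}+w_ix_i^*$. The competitive ratio $\mathrm{CR}$ of an algorithm is the worst-case ratio $\mathrm{OPT}/\mathrm{ALG}$ of the offline optimal value to the algorithm's value. Under assumption (1) it is understood in the infinitesimal-weight limit: the limit as $\delta\to0^+$ of the supremum of $\mathrm{OPT}/\mathrm{ALG}$ over all instances (with at least one item) satisfying (2) and $\max_i w_i\le\delta$. The degradation factor of $\mathrm{OKP\text{ - }Alg}(\alpha)$ with respect to the baseline $\mathrm{OKP\text{ - }Alg}(1)$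 is the worst-case performance degradation, namely the (smallest) factor with $\mathrm{CR}(\mathrm{OKP\text{ - }Alg}(\alpha))\le\mathrm{DF}\cdot\mathrm{CR}(\mathrm{OKP\text{ - }Alg}(1))$. -}

module Defs where

open import Algebra.Bundles using (CommutativeRing; Semiring)
import Algebra.Construct.NaturalChoice.Min as NaturalMin
import Algebra.Definitions.RawSemiring as RawSemiringOps
open import Algebra.Structures using (IsCommutativeRing)
open import Data.Bool.Base using (Bool; _∧_; if_then_else_)
open import Data.List.Base using (List; []; _∷_)
open import Data.Nat.Base as ℕ using (ℕ; suc)
open import Data.Product.Base using (_×_; _,_; ∃; Σ-syntax)
open import Data.Vec.Base using (Vec; []; _∷_)
open import Data.Vec.Relation.Unary.All using (All)
open import Level using (0ℓ)
open import Relation.Binary.Bundles using (DecTotalOrder)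
import Relation.Binary.Construct.Add.Supremum.NonStrict as WithInfinity
import Relation.Binary.Construct.NonStrictToStrict as ToStrict
open import Relation.Binary.Core using (Rel)
open import Relation.Binary.Definitions using (Decidable)
open import Relation.Binary.PropositionalEquality.Core using (_≡_; _≢_)
open import Relation.Binary.Structures using (IsDecTotalOrder)
open import Relation.Nullary.Construct.Add.Supremum using (_⁺; ⊤⁺; [_])
open import Relation.Nullary.Decidable.Core using (does)

IsUpperBound : {A : Set} → Rel A 0ℓ → (A → Set) → A → Set
IsUpperBound _≤_ P b = ∀ x → P x → x ≤ b

IsLeast : {A : Set} → Rel A 0ℓ → (A → Set) → A → Set
IsLeast _≤_ P m = P m × (∀ x → P x → m ≤ x)

IsSupremum : {A : Set} → Rel A 0ℓ → (A → Set) → A → Set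
IsSupremum _≤_ P s = IsLeast _≤_ (IsUpperBound _≤_ P) s

-- The real numbers of classical analysis, which are up to isomorphism the only
-- complete ordered field.

record CompleteOrderedField : Set₁ where
  infix  8 -_
  infixl 7 _*_ _/_
  infixl 6 _+_
  infix  4 _≤_
  infix  9 _⁻¹

  field
    ℝ     : Set
    _+_   : ℝ → ℝ → ℝ
    _*_   : ℝ → ℝ → ℝ
    -_    : ℝ → ℝ
    0#    : ℝ
    1#    : ℝ
    _⁻¹   : ℝ → ℝ        -- 0# ⁻¹ is left unspecified
    _≤_   : ℝ → ℝ → Set

    isCommutativeRing : IsCommutativeRing _≡_ _+_ _*_ -_ 0# 1#
    1≢0               : 1# ≢ 0#
    ⁻¹-inverseʳ       : ∀ x → x ≢ 0# → x * x ⁻¹ ≡ 1#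

    isDecTotalOrder   : IsDecTotalOrder _≡_ _≤_
    +-monoʳ-≤         : ∀ z x y → x ≤ y → z + x ≤ z + y
    *-nonneg          : ∀ x y → 0# ≤ x → 0# ≤ y → 0# ≤ x * y

    supremum          : (P : ℝ → Set) → ∃ P → ∃ (IsUpperBound _≤_ P) →
                        ∃ (IsSupremum _≤_ P)

  commutativeRing : CommutativeRing 0ℓ 0ℓ
  commutativeRing = record { isCommutativeRing = isCommutativeRing }

  decTotalOrder : DecTotalOrder 0ℓ 0ℓ 0ℓ
  decTotalOrder = record { isDecTotalOrder = isDecTotalOrder }

  open CommutativeRing commutativeRing public using (_-_)
  open RawSemiringOps
    (Semiring.rawSemiring (CommutativeRing.semiring commutativeRing)) public
    using (_^_) renaming (_×_ to _·_)
  open DecTotalOrder decTotalOrder public using (_≤?_; _≟_; totalOrder)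
  open ToStrict _≡_ _≤_ public using (_<_)
  open NaturalMin totalOrder public using () renaming (_⊓_ to min)

  field
    -- Follows from completeness classically, but not constructively in this
    -- witness-producing form.
    archimedean : ∀ x → Σ[ n ∈ ℕ ] x ≤ n · 1#

  _<?_ : Decidable _<_
  _<?_ = ToStrict.<-decidable _≡_ _≤_ _≟_ _≤?_

  _/_ : ℝ → ℝ → ℝ
  x / y = x * y ⁻¹

  Between : ℝ → ℝ → ℝ → Set
  Between a b x = a < x × x < b

  ConvergesTo : (ℕ → ℝ) → ℝ → Set
  ConvergesTo s l = ∀ ε → 0# < ε → Σ[ N ∈ ℕ ] (∀ n → N ℕ.≤ n →
    Between (l - ε) (l + ε) (s n))

-- ln is only specified on the positive reals.

record ExpLog (R : CompleteOrderedField) : Set where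
  open CompleteOrderedField R
  field
    exp       : ℝ → ℝ
    exp-limit : ∀ x →
      ConvergesTo (λ n → (1# + x / (suc n · 1#)) ^ suc n) (exp x)
    ln        : ℝ → ℝ
    exp-ln    : ∀ y → 0# < y → exp (ln y) ≡ y

  infixr 8 _^ʳ_
  _^ʳ_ : ℝ → ℝ → ℝ
  x ^ʳ a = exp (a * ln x)

-- L and U bound the value densities.

module Knapsack (R : CompleteOrderedField) (E : ExpLog R)
                (L U : CompleteOrderedField.ℝ R) where

  open CompleteOrderedField R
  open ExpLog E

  record Item : Set where
    field
      value      : ℝ
      weight     : ℝ
      value-pos  : 0# < value
      weight-pos : 0# < weight

  open Item public

  density : Item → ℝ
  density i = value i / weight i

  Instance : ℕ → Set
  Instance = Vec Item

  Decisions : ℕ → Set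
  Decisions = Vec Bool

  totalValue : ∀ {n} → Instance n → Decisions n → ℝ
  totalValue []       []       = 0#
  totalValue (i ∷ is) (x ∷ xs) =
    (if x then value i else 0#) + totalValue is xs

  totalWeight : ∀ {n} → Instance n → Decisions n → ℝ
  totalWeight []       []       = 0#
  totalWeight (i ∷ is) (x ∷ xs) =
    (if x then weight i else 0#) + totalWeight is xs

  Feasible : ∀ {n} → Instance n → Decisions n → Set
  Feasible is xs = totalWeight is xs ≤ 1#

  IsOfflineOptimum : ∀ {n} → Instance n → ℝ → Set
  IsOfflineOptimum {n} is o =
    (Σ[ xs ∈ Decisions n ] (Feasible is xs × totalValue is xs ≡ o)) ×
    (∀ xs → Feasible is xs → totalValue is xs ≤ o)

  -- Past items with the decisions taken on them, most recent first.
  History : Set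
  History = List (Item × Bool)

  OnlineAlgorithm : Set
  OnlineAlgorithm = History → Item → Bool

  runFrom : OnlineAlgorithm → History → ∀ {n} → Instance n → Decisions n
  runFrom A h []       = []
  runFrom A h (i ∷ is) = A h i ∷ runFrom A ((i , A h i) ∷ h) is

  run : OnlineAlgorithm → ∀ {n} → Instance n → Decisions n
  run A = runFrom A []

  algValue : OnlineAlgorithm → ∀ {n} → Instance n → ℝ
  algValue A is = totalValue is (run A is)

  Admissible : ℝ → Item → Set
  Admissible δ i = L ≤ density i × density i ≤ U × weight i ≤ δ

  -- If δ ≤ 1 and A accepts the first item, the denominator is positive; larger
  -- δ play no role in the limit below.
  PerformanceRatio : OnlineAlgorithm → ℝ → ℝ → Set
  PerformanceRatio A δ r =
    Σ[ n ∈ ℕ ] Σ[ is ∈ Instance (suc n) ] (All (Admissible δ) is ×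
      Σ[ o ∈ ℝ ] (IsOfflineOptimum is o × r ≡ o / algValue A is))

  -- c is the limit, as δ → 0⁺, of the supremum of the performance ratios; the
  -- supremum is required to be finite for all small δ.
  IsCompetitiveRatio : OnlineAlgorithm → ℝ → Set
  IsCompetitiveRatio A c =
    ∀ ε → 0# < ε → Σ[ δ₀ ∈ ℝ ] (0# < δ₀ × (∀ δ → 0# < δ → δ < δ₀ →
      Σ[ s ∈ ℝ ] (IsSupremum _≤_ (PerformanceRatio A δ) s ×
                  Between (c - ε) (c + ε) s)))

  IsDegradationFactor : OnlineAlgorithm → OnlineAlgorithm → ℝ → Set
  IsDegradationFactor A B d =
    Σ[ a ∈ ℝ ] Σ[ b ∈ ℝ ] (IsCompetitiveRatio A a × IsCompetitiveRatio B b ×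
      IsLeast _≤_ (λ f → a ≤ f * b) d)

  γ : ℝ
  γ = U / L

  T : ℝ
  T = 1# / (ln γ + 1#)

  -- Utilizations lie in [0,1], so the last case is z = 1.
  Ψ : ℝ → ℝ → ℝ ⁺
  Ψ α z =
    if does (z <? T) then [ L ]
    else if does (z <? 1#) then [ min U (L * exp (α * (z / T - 1#))) ]
    else ⊤⁺

  open WithInfinity _≤_ using (_≤⁺_; ≤⁺-dec)

  _≤⁺?_ : Decidable _≤⁺_
  _≤⁺?_ = ≤⁺-dec _≤?_

  utilization : History → ℝ
  utilization []            = 0#
  utilization ((i , x) ∷ h) =
    utilization h + (if x then weight i else 0#)

  OKP-Alg : ℝ → OnlineAlgorithm
  OKP-Alg α h i =
    does (Ψ α (utilization h) ≤⁺? [ density i ]) ∧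
    does (utilization h + weight i ≤? 1#)

  degradationFormula : ℝ → ℝ
  degradationFormula α = if does (1# ≤? α)
         then α * γ / (α + γ - 1#)
         else α * γ / (α + γ ^ʳ α - 1#)

-- Charge every admitted item the threshold price at its arrival. Up to an error
-- proportional to the maximal weight, the total charge S is at least the
-- integral of the threshold over the utilizations passed. Weak duality with a
-- uniform price p per unit of capacity (the final threshold, or U when the
-- knapsack is full) gives OPT ≤ p + ALG − S, and S ≤ ALG, so OPT / ALG is at
-- most max (1, p / S). On [T, 1] the uncapped threshold m satisfies
-- m′ = (α / T) m, so the integral is affine in m and p / S is largest at the
-- utilization z* where the threshold stops rising. Conversely, items of density
-- equal to the threshold up to z*, followed by a knapsack full of items of
-- density just below U, attain U / ∫₀^z* Ψ = degradationFormula α / T.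
-- About exp this needs only exp a · (1 + u) ≤ exp (a + u) and exp 0 = 1; the
-- former is the limit of Bernoulli's inequality.

module Submission where

open import Defs
open import Algebra.Bundles using (CommutativeRing)
import Algebra.Properties.Ring as RingProperties
import Algebra.Properties.Semiring.Mult.TCOptimised as Multiples
import Algebra.Solver.Ring as RingSolver
open import Algebra.Solver.Ring.AlmostCommutativeRing using (fromCommutativeRing; _-Raw-AlmostCommutative⟶_; Induced-equivalence)
open import Data.Bool.Base using (Bool; true; false; if_then_else_; _∧_)
open import Data.Bool.Properties using (∧-zeroʳ)
open import Data.Empty using (⊥; ⊥-elim)
open import Data.Integer.Base as ℤ using (ℤ)
import Data.Integer.Properties as ℤ
open import Data.List.Base using ([]; _∷_)
open import Data.Maybe.Base using (just; nothing)
open import Data.Nat.Base as ℕ using (ℕ; zero; suc)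
import Data.Nat.Properties as ℕ
open import Data.Product.Base using (_×_; _,_; proj₁; proj₂; Σ-syntax)
open import Data.Sign.Base as Sign using (Sign)
open import Data.Sum.Base as Sum using (_⊎_; inj₁; inj₂)
open import Data.Vec.Base using ([]; _∷_; replicate)
open import Data.Vec.Relation.Unary.All using (All; []; _∷_)
open import Relation.Binary.Bundles using (DecTotalOrder)
import Relation.Binary.Construct.Add.Supremum.NonStrict as WithInfinity
open import Relation.Binary.Definitions using (WeaklyDecidable)
open import Relation.Binary.PropositionalEquality using (_≡_; refl; sym; trans; cong; cong₂; subst; subst₂; module ≡-Reasoning)
open import Relation.Nullary using (¬_; Dec; yes; no)
open import Relation.Nullary.Construct.Add.Supremum using (⊤⁺; [_])
open import Relation.Nullary.Decidable using (does; dec-true; dec-false)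

-- The two branches of the formula are one expression. At utilization 1 the uncapped threshold is L
-- γ^α, so it stops rising at density L e^h with h = min (ln γ, α ln γ), and the integral up to
-- there is (L T / α)(α + e^h - 1). Dividing U by it gives (1 / T) · αγ / (α + e^h - 1), where e^h
-- is γ or γ^α. For α = 1 the second factor is 1, so the baseline has ratio 1 / T. The delicate end
-- of a run is the full knapsack: the dual price must jump to U, above the last threshold if α < 1,
-- and only the whole integral covers it. The closed form `potential` replaces the integral, and the
-- tangent inequality for exp, read from either end of a step, bounds its increments. Charges form
-- left Riemann sums of a rising price; lowering one coefficient of `potential` by the maximal
-- weight absorbs their deficit, which thus telescopes instead of growing with the number of items.

-- Integer coefficients for the ring solver.

module IntegerCoefficients {c ℓ} (A : CommutativeRing c ℓ) where
  open import Data.Integer.Base using (+_; -[1+_]; _⊖_)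
  open CommutativeRing A renaming (refl to ≈-refl; sym to ≈-sym; trans to ≈-trans)
  open Multiples semiring renaming (_×_ to _×′_)
  open RingProperties ring using (-‿involutive; -0#≈0#; -‿+-comm; -‿distribˡ-*; -‿distribʳ-*)
  open import Relation.Binary.Reasoning.Setoid setoid

  -- Integers serve as coefficients because their equality computes, so `solve` can cancel terms in
  -- an abstract ring. The optimised multiple makes the images of 0 and 1 reduce to `0#` and `1#`,
  -- which lets `:0` and `:1` match goals literally.
  fromℤ : ℤ → Carrier
  fromℤ (+ n)    = n ×′ 1#
  fromℤ -[1+ n ] = - (suc n ×′ 1#)

  cancel : ∀ a b → (1# + a) + - (1# + b) ≈ a + - b
  cancel a b = begin
    (1# + a) + - (1# + b)     ≈⟨ +-cong (+-comm 1# a) (≈-sym (-‿+-comm 1# b)) ⟩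
    (a + 1#) + (- 1# + - b)   ≈⟨ +-assoc a 1# _ ⟩
    a + (1# + (- 1# + - b))   ≈⟨ +-congˡ (+-assoc 1# (- 1#) (- b)) ⟨
    a + ((1# + - 1#) + - b)   ≈⟨ +-congˡ (+-congʳ (-‿inverseʳ 1#)) ⟩
    a + (0# + - b)            ≈⟨ +-congˡ (+-identityˡ (- b)) ⟩
    a + - b                   ∎

  fromℤ-⊖ : ∀ m n → fromℤ (m ⊖ n) ≈ m ×′ 1# + - (n ×′ 1#)
  fromℤ-⊖ zero    zero    = begin
    0#        ≈⟨ -‿inverseʳ 0# ⟨
    0# + - 0# ∎
  fromℤ-⊖ zero    (suc n) = begin
    - (suc n ×′ 1#)       ≈⟨ +-identityˡ _ ⟨
    0# + - (suc n ×′ 1#)  ∎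
  fromℤ-⊖ (suc m) zero    = begin
    suc m ×′ 1#           ≈⟨ +-identityʳ _ ⟨
    suc m ×′ 1# + 0#      ≈⟨ +-congˡ -0#≈0# ⟨
    suc m ×′ 1# + - 0#    ∎
  fromℤ-⊖ (suc m) (suc n) = begin
    fromℤ (suc m ⊖ suc n)               ≡⟨ cong fromℤ (ℤ.[1+m]⊖[1+n]≡m⊖n m n) ⟩
    fromℤ (m ⊖ n)                       ≈⟨ fromℤ-⊖ m n ⟩
    m ×′ 1# + - (n ×′ 1#)               ≈⟨ cancel _ _ ⟨
    (1# + m ×′ 1#) + - (1# + n ×′ 1#)   ≈⟨ +-cong (1+× m 1#) (-‿cong (1+× n 1#)) ⟨
    suc m ×′ 1# + - (suc n ×′ 1#)       ∎

  fromℤ-+ : ∀ i j → fromℤ (i ℤ.+ j) ≈ fromℤ i + fromℤ j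
  fromℤ-+ (+ m)    (+ n)    = ×-homo-+ 1# m n
  fromℤ-+ (+ m)    -[1+ n ] = fromℤ-⊖ m (suc n)
  fromℤ-+ -[1+ m ] (+ n)    = begin
    fromℤ (n ⊖ suc m)            ≈⟨ fromℤ-⊖ n (suc m) ⟩
    n ×′ 1# + - (suc m ×′ 1#)    ≈⟨ +-comm _ _ ⟩
    - (suc m ×′ 1#) + n ×′ 1#    ∎
  fromℤ-+ -[1+ m ] -[1+ n ] = begin
    - (suc (suc (m ℕ.+ n)) ×′ 1#)         ≡⟨ cong (λ k → - (suc k ×′ 1#)) (ℕ.+-suc m n) ⟨
    - ((suc m ℕ.+ suc n) ×′ 1#)           ≈⟨ -‿cong (×-homo-+ 1# (suc m) (suc n)) ⟩
    - (suc m ×′ 1# + suc n ×′ 1#)         ≈⟨ -‿+-comm _ _ ⟨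
    - (suc m ×′ 1#) + - (suc n ×′ 1#)     ∎

  fromℤ-neg : ∀ i → fromℤ (ℤ.- i) ≈ - fromℤ i
  fromℤ-neg (+ zero)    = begin
    0#    ≈⟨ -0#≈0# ⟨
    - 0#  ∎
  fromℤ-neg (+ (suc n)) = ≈-refl
  fromℤ-neg -[1+ n ]    = begin
    suc n ×′ 1#          ≈⟨ -‿involutive _ ⟨
    - - (suc n ×′ 1#)    ∎

  signed : Sign → Carrier → Carrier
  signed Sign.+ x = x
  signed Sign.- x = - x

  fromℤ-◃ : ∀ s n → fromℤ (s ℤ.◃ n) ≈ signed s (n ×′ 1#)
  fromℤ-◃ Sign.+ zero    = begin 0# ∎
  fromℤ-◃ Sign.+ (suc n) = begin suc n ×′ 1# ∎
  fromℤ-◃ Sign.- zero    = begin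
    0#    ≈⟨ -0#≈0# ⟨
    - 0#  ∎
  fromℤ-◃ Sign.- (suc n) = begin - (suc n ×′ 1#) ∎

  fromℤ-* : ∀ i j → fromℤ (i ℤ.* j) ≈ fromℤ i * fromℤ j
  fromℤ-* (+ m) (+ n) = begin
    fromℤ (Sign.+ ℤ.◃ (m ℕ.* n))         ≈⟨ fromℤ-◃ Sign.+ (m ℕ.* n) ⟩
    (m ℕ.* n) ×′ 1#                      ≈⟨ ×1-homo-* m n ⟩
    m ×′ 1# * n ×′ 1#                    ∎
  fromℤ-* (+ m) -[1+ n ] = begin
    fromℤ (Sign.- ℤ.◃ (m ℕ.* suc n))     ≈⟨ fromℤ-◃ Sign.- (m ℕ.* suc n) ⟩
    - ((m ℕ.* suc n) ×′ 1#)              ≈⟨ -‿cong (×1-homo-* m (suc n)) ⟩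
    - (m ×′ 1# * suc n ×′ 1#)            ≈⟨ -‿distribʳ-* _ _ ⟩
    m ×′ 1# * - (suc n ×′ 1#)            ∎
  fromℤ-* -[1+ m ] (+ n) = begin
    fromℤ (Sign.- ℤ.◃ (suc m ℕ.* n))     ≈⟨ fromℤ-◃ Sign.- (suc m ℕ.* n) ⟩
    - ((suc m ℕ.* n) ×′ 1#)              ≈⟨ -‿cong (×1-homo-* (suc m) n) ⟩
    - (suc m ×′ 1# * n ×′ 1#)            ≈⟨ -‿distribˡ-* _ _ ⟩
    - (suc m ×′ 1#) * n ×′ 1#            ∎
  fromℤ-* -[1+ m ] -[1+ n ] = begin
    (suc m ℕ.* suc n) ×′ 1#                    ≈⟨ ×1-homo-* (suc m) (suc n) ⟩
    suc m ×′ 1# * suc n ×′ 1#                  ≈⟨ -‿involutive _ ⟨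
    - - (suc m ×′ 1# * suc n ×′ 1#)            ≈⟨ -‿cong (-‿distribʳ-* _ _) ⟩
    - (suc m ×′ 1# * - (suc n ×′ 1#))          ≈⟨ -‿distribˡ-* _ _ ⟩
    - (suc m ×′ 1#) * - (suc n ×′ 1#)          ∎

  morphism : ℤ.+-*-rawRing -Raw-AlmostCommutative⟶ fromCommutativeRing A
  morphism = record
    { ⟦_⟧    = fromℤ
    ; +-homo = fromℤ-+
    ; *-homo = fromℤ-*
    ; -‿homo = fromℤ-neg
    ; 0-homo = begin 0# ∎
    ; 1-homo = begin 1# ∎
    }

  fromℤ-≟ : WeaklyDecidable (Induced-equivalence morphism)
  fromℤ-≟ i j with i ℤ.≟ j
  ... | yes i≡j = just (begin fromℤ i ≡⟨ cong fromℤ i≡j ⟩ fromℤ j ∎)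
  ... | no _    = nothing

  open RingSolver ℤ.+-*-rawRing (fromCommutativeRing A) morphism fromℤ-≟ public
    using (Polynomial; con; solve; _:=_; _:+_; _:*_; _:-_; :-_)

-- Order, division and minima in the ordered field.

module OrderedField (R : CompleteOrderedField) where
  open CompleteOrderedField R public
  open CommutativeRing commutativeRing public
    using (+-comm; +-identityˡ; +-identityʳ; *-comm; *-assoc; *-identityˡ)
    renaming (zeroˡ to *-zeroˡ; zeroʳ to *-zeroʳ)
  open DecTotalOrder decTotalOrder public using ()
    renaming (refl to ≤-refl; reflexive to ≤-reflexive; trans to ≤-trans; antisym to ≤-antisym; total to ≤-total)
  open IntegerCoefficients commutativeRing public
    using (Polynomial; con; solve; _:=_; _:+_; _:*_; _:-_; :-_)

  :0 :1 : ∀ {n} → Polynomial n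
  :0 = con (ℤ.+ 0)
  :1 = con (ℤ.+ 1)

  -- b − a = y − x reduces a ≤ b to x ≤ y, so that an inequality follows from
  -- others by exhibiting a combination of them and a ring identity.
  by-≤ : ∀ {a b x y} → x ≤ y → b - a ≡ y - x → a ≤ b
  by-≤ {a} {b} {x} {y} x≤y eq = subst₂ _≤_ lhs rhs (+-monoʳ-≤ (a - x) x y x≤y)
    where
    lhs : (a - x) + x ≡ a
    lhs = solve 2 (λ a x → (a :- x) :+ x := a) refl a x
    rhs : (a - x) + y ≡ b
    rhs = trans (solve 3 (λ a x y → (a :- x) :+ y := (y :- x) :+ a) refl a x y)
          (trans (cong (_+ a) (sym eq)) (solve 2 (λ a b → (b :- a) :+ a := b) refl a b))

  by-< : ∀ {a b x y} → x < y → b - a ≡ y - x → a < b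
  by-< {a} {b} {x} {y} (x≤y , x≢y) eq = by-≤ x≤y eq , λ a≡b → x≢y (begin
    x             ≡⟨ solve 2 (λ x y → x := y :- (y :- x)) refl x y ⟩
    y - (y - x)   ≡⟨ cong (λ t → y - t) (sym eq) ⟩
    y - (b - a)   ≡⟨ cong (λ t → y - (b - t)) a≡b ⟩
    y - (b - b)   ≡⟨ solve 2 (λ b y → y :- (b :- b) := y) refl b y ⟩
    y             ∎)
    where open ≡-Reasoning

  <⇒≤ : ∀ {x y} → x < y → x ≤ y
  <⇒≤ = proj₁

  <-irrefl : ∀ {x} → ¬ x < x
  <-irrefl (_ , x≢x) = x≢x refl

  <-≤-trans : ∀ {x y z} → x < y → y ≤ z → x < z
  <-≤-trans (x≤y , x≢y) y≤z = ≤-trans x≤y y≤z , λ { refl → x≢y (≤-antisym x≤y y≤z) }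

  ≤-<-trans : ∀ {x y z} → x ≤ y → y < z → x < z
  ≤-<-trans x≤y (y≤z , y≢z) = ≤-trans x≤y y≤z , λ { refl → y≢z (≤-antisym y≤z x≤y) }

  <-trans : ∀ {x y z} → x < y → y < z → x < z
  <-trans x<y y<z = <-≤-trans x<y (<⇒≤ y<z)

  <⇒≱ : ∀ {x y} → x < y → ¬ y ≤ x
  <⇒≱ x<y y≤x = <-irrefl (<-≤-trans x<y y≤x)

  ≰⇒> : ∀ {x y} → ¬ x ≤ y → y < x
  ≰⇒> {x} {y} x≰y with ≤-total x y
  ... | inj₁ x≤y = ⊥-elim (x≰y x≤y)
  ... | inj₂ y≤x = y≤x , λ { refl → x≰y ≤-refl }

  ≮⇒≥ : ∀ {x y} → ¬ x < y → y ≤ x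
  ≮⇒≥ {x} {y} x≮y with y ≤? x
  ... | yes y≤x = y≤x
  ... | no y≰x  = ⊥-elim (x≮y (≰⇒> y≰x))

  infixr 5 _⊕_ _⊕<_
  infixr 6 _⊛_ _⊛<_

  _⊕_ : ∀ {a b c d} → a ≤ b → c ≤ d → a + c ≤ b + d
  _⊕_ {a} {b} {c} {d} a≤b c≤d = ≤-trans
    (by-≤ a≤b (solve 3 (λ a b c → b :+ c :- (a :+ c) := b :- a) refl a b c))
    (by-≤ c≤d (solve 3 (λ b c d → b :+ d :- (b :+ c) := d :- c) refl b c d))

  _⊕<_ : ∀ {a b c d} → a < b → c ≤ d → a + c < b + d
  _⊕<_ {a} {b} {c} {d} a<b c≤d = <-≤-trans
    (by-< a<b (solve 3 (λ a b c → b :+ c :- (a :+ c) := b :- a) refl a b c))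
    (by-≤ c≤d (solve 3 (λ b c d → b :+ d :- (b :+ c) := d :- c) refl b c d))

  ≤⇒0≤- : ∀ {x y} → x ≤ y → 0# ≤ y - x
  ≤⇒0≤- {x} {y} x≤y = by-≤ x≤y (solve 2 (λ x y → (y :- x) :- :0 := y :- x) refl x y)

  <⇒0<- : ∀ {x y} → x < y → 0# < y - x
  <⇒0<- {x} {y} x<y = by-< x<y (solve 2 (λ x y → (y :- x) :- :0 := y :- x) refl x y)

  0≤-⇒≤ : ∀ {x y} → 0# ≤ y - x → x ≤ y
  0≤-⇒≤ {x} {y} p = by-≤ p (solve 2 (λ x y → y :- x := (y :- x) :- :0) refl x y)

  _⊛_ : ∀ {k a b} → 0# ≤ k → a ≤ b → k * a ≤ k * b
  _⊛_ {k} {a} {b} 0≤k a≤b = by-≤ (*-nonneg k (b - a) 0≤k (≤⇒0≤- a≤b))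
    (solve 3 (λ k a b → k :* b :- k :* a := k :* (b :- a) :- :0) refl k a b)

  0≤1 : 0# ≤ 1#
  0≤1 with ≤-total 0# 1#
  ... | inj₁ 0≤1 = 0≤1
  ... | inj₂ 1≤0 = subst (0# ≤_) (solve 0 ((:0 :- :1) :* (:0 :- :1) := :1) refl)
                     (*-nonneg _ _ (≤⇒0≤- 1≤0) (≤⇒0≤- 1≤0))

  0<1 : 0# < 1#
  0<1 = 0≤1 , λ 0≡1 → 1≢0 (sym 0≡1)

  *-pos : ∀ {x y} → 0# < x → 0# < y → 0# < x * y
  *-pos {x} {y} 0<x 0<y = *-nonneg x y (<⇒≤ 0<x) (<⇒≤ 0<y) , λ 0≡xy → proj₂ 0<y (begin
    0#              ≡⟨ *-zeroˡ (x ⁻¹) ⟨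
    0# * x ⁻¹       ≡⟨ cong (_* x ⁻¹) 0≡xy ⟩
    x * y * x ⁻¹    ≡⟨ solve 3 (λ x y z → x :* y :* z := (x :* z) :* y) refl x y (x ⁻¹) ⟩
    x * x ⁻¹ * y    ≡⟨ cong (_* y) (⁻¹-inverseʳ x λ x≡0 → proj₂ 0<x (sym x≡0)) ⟩
    1# * y          ≡⟨ *-identityˡ y ⟩
    y               ∎)
    where open ≡-Reasoning

  _⊛<_ : ∀ {k a b} → 0# < k → a < b → k * a < k * b
  _⊛<_ {k} {a} {b} 0<k a<b = by-< (*-pos 0<k (<⇒0<- a<b))
    (solve 3 (λ k a b → k :* b :- k :* a := k :* (b :- a) :- :0) refl k a b)

  *-cancelˡ-≤ : ∀ {k a b} → 0# < k → k * a ≤ k * b → a ≤ b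
  *-cancelˡ-≤ 0<k ka≤kb = ≮⇒≥ λ b<a → <⇒≱ (0<k ⊛< b<a) ka≤kb

  *-cancelˡ-≡ : ∀ {k a b} → 0# < k → k * a ≡ k * b → a ≡ b
  *-cancelˡ-≡ 0<k eq = ≤-antisym (*-cancelˡ-≤ 0<k (≤-reflexive eq)) (*-cancelˡ-≤ 0<k (≤-reflexive (sym eq)))

  +-pos : ∀ {x y} → 0# < x → 0# ≤ y → 0# < x + y
  +-pos {x} {y} 0<x 0≤y = subst (_< x + y) (+-identityˡ 0#) (0<x ⊕< 0≤y)

  +-nonneg : ∀ {x y} → 0# ≤ x → 0# ≤ y → 0# ≤ x + y
  +-nonneg {x} {y} 0≤x 0≤y = subst (_≤ x + y) (+-identityˡ 0#) (0≤x ⊕ 0≤y)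

  inverse : ∀ {x} → 0# < x → x * x ⁻¹ ≡ 1#
  inverse {x} 0<x = ⁻¹-inverseʳ x λ x≡0 → proj₂ 0<x (sym x≡0)

  ⁻¹-pos : ∀ {x} → 0# < x → 0# < x ⁻¹
  ⁻¹-pos {x} 0<x = ≰⇒> λ x⁻¹≤0 → <⇒≱ 0<1 (subst₂ _≤_ (inverse 0<x) (*-zeroʳ x) (<⇒≤ 0<x ⊛ x⁻¹≤0))

  *-/-cancel : ∀ x {y} → 0# < y → y * (x / y) ≡ x
  *-/-cancel x {y} 0<y = begin
    y * (x * y ⁻¹)  ≡⟨ solve 3 (λ x y z → y :* (x :* z) := y :* z :* x) refl x y (y ⁻¹) ⟩
    y * y ⁻¹ * x    ≡⟨ cong (_* x) (inverse 0<y) ⟩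
    1# * x          ≡⟨ *-identityˡ x ⟩
    x               ∎
    where open ≡-Reasoning

  /-pos : ∀ {x y} → 0# < x → 0# < y → 0# < x / y
  /-pos 0<x 0<y = *-pos 0<x (⁻¹-pos 0<y)

  /-unique : ∀ {x y q} → 0# < y → y * q ≡ x → x / y ≡ q
  /-unique {x} 0<y eq = *-cancelˡ-≡ 0<y (trans (*-/-cancel x 0<y) (sym eq))

  ≤*⇒/≤ : ∀ {x y q} → 0# < y → x ≤ y * q → x / y ≤ q
  ≤*⇒/≤ {x} {y} {q} 0<y x≤yq = *-cancelˡ-≤ 0<y (subst (_≤ y * q) (sym (*-/-cancel x 0<y)) x≤yq)

  *≤⇒≤/ : ∀ {x y q} → 0# < y → y * q ≤ x → q ≤ x / y
  *≤⇒≤/ {x} {y} {q} 0<y yq≤x = *-cancelˡ-≤ 0<y (subst (y * q ≤_) (sym (*-/-cancel x 0<y)) yq≤x)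

  min-≤ˡ : ∀ x y → min x y ≤ x
  min-≤ˡ x y with ≤-total x y
  ... | inj₁ _   = ≤-refl
  ... | inj₂ y≤x = y≤x

  min-≤ʳ : ∀ x y → min x y ≤ y
  min-≤ʳ x y with ≤-total x y
  ... | inj₁ x≤y = x≤y
  ... | inj₂ _   = ≤-refl

  min-glb : ∀ {x y z} → z ≤ x → z ≤ y → z ≤ min x y
  min-glb {x} {y} z≤x z≤y with ≤-total x y
  ... | inj₁ _ = z≤x
  ... | inj₂ _ = z≤y

  min-≤ : ∀ {x y} → x ≤ y → min x y ≡ x
  min-≤ x≤y = ≤-antisym (min-≤ˡ _ _) (min-glb ≤-refl x≤y)

  min-≥ : ∀ {x y} → y ≤ x → min x y ≡ y
  min-≥ y≤x = ≤-antisym (min-≤ʳ _ _) (min-glb y≤x ≤-refl)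

  min-pos : ∀ {x y} → 0# < x → 0# < y → 0# < min x y
  min-pos {x} {y} 0<x 0<y = min-glb (<⇒≤ 0<x) (<⇒≤ 0<y) , λ 0≡min → Sum.[
    (λ x≤y → proj₂ 0<x (trans 0≡min (min-≤ x≤y))) , (λ y≤x → proj₂ 0<y (trans 0≡min (min-≥ y≤x))) ]′ (≤-total x y)

  ·-suc-pos : ∀ n → 0# < suc n · 1#
  ·-suc-pos zero    = +-pos 0<1 ≤-refl
  ·-suc-pos (suc n) = +-pos 0<1 (<⇒≤ (·-suc-pos n))

-- Limits of sequences.

module Limits (R : CompleteOrderedField) where
  open OrderedField R

  2# ½ : ℝ
  2# = 1# + 1#
  ½  = 2# ⁻¹

  0<2 : 0# < 2#
  0<2 = +-pos 0<1 0≤1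

  0<½ : 0# < ½
  0<½ = ⁻¹-pos 0<2

  ½+½ : ½ + ½ ≡ 1#
  ½+½ = trans (solve 1 (λ h → h :+ h := (:1 :+ :1) :* h) refl ½) (inverse 0<2)

  halves : ∀ x → ½ * x + ½ * x ≡ x
  halves x = trans (solve 2 (λ h x → h :* x :+ h :* x := (h :+ h) :* x) refl ½ x)
             (trans (cong (_* x) ½+½) (*-identityˡ x))

  ½*-< : ∀ {x} → 0# < x → ½ * x < x
  ½*-< {x} 0<x = by-< (*-pos 0<½ 0<x)
      (trans (cong (_- ½ * x) (sym (halves x))) (solve 1 (λ y → y :+ y :- y := y :- :0) refl (½ * x)))

  midpoint : ∀ a b → a - ½ * (a - b) ≡ b + ½ * (a - b)
  midpoint a b = trans
    (cong (_- ½ * (a - b)) (trans (solve 2 (λ a b → a := b :+ (a :- b)) refl a b) (cong (b +_) (sym (halves (a - b))))))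
    (solve 2 (λ b h → b :+ (h :+ h) :- h := b :+ h) refl b (½ * (a - b)))

  Within : ℝ → ℝ → Set
  Within e x = Between (- e) e x

  within⇒between : ∀ {l e s} → Within e (s - l) → Between (l - e) (l + e) s
  within⇒between {l} {e} {s} (p , q) =
    by-< p (solve 3 (λ l e s → s :- (l :- e) := s :- l :- :- e) refl l e s) ,
    by-< q (solve 3 (λ l e s → l :+ e :- s := e :- (s :- l)) refl l e s)

  between⇒within : ∀ {l e s} → Between (l - e) (l + e) s → Within e (s - l)
  between⇒within {l} {e} {s} (p , q) =
    by-< p (solve 3 (λ l e s → s :- l :- :- e := s :- (l :- e)) refl l e s) ,
    by-< q (solve 3 (λ l e s → e :- (s :- l) := l :+ e :- s) refl l e s)

  within-+ : ∀ {e f s t} → Within e s → Within f t → Within (e + f) (s + t)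
  within-+ {e} {f} {s} {t} (p , q) (p′ , q′) =
    by-< (p ⊕< <⇒≤ p′) (solve 4 (λ e f s t → s :+ t :- :- (e :+ f) := s :+ t :- (:- e :+ :- f)) refl e f s t) ,
    q ⊕< <⇒≤ q′

  -- 2 (ef ∓ st) = (e − s)(f ± t) + (e + s)(f ∓ t).
  within-* : ∀ {e f s t} → Within e s → Within f t → Within (e * f) (s * t)
  within-* {e} {f} {s} {t} (p , q) (p′ , q′) =
    by-< (0<½ ⊛< +-pos (*-pos e-s f-t) (<⇒≤ (*-pos e+s f+t))) (trans (sym (halves (s * t - - (e * f))))
      (solve 5 (λ h e f s t → h :* (s :* t :- :- (e :* f)) :+ h :* (s :* t :- :- (e :* f))
                              := h :* ((e :- s) :* (f :- t) :+ (e :+ s) :* (f :+ t)) :- h :* :0) refl ½ e f s t)) ,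
    by-< (0<½ ⊛< +-pos (*-pos e-s f+t) (<⇒≤ (*-pos e+s f-t))) (trans (sym (halves (e * f - s * t)))
      (solve 5 (λ h e f s t → h :* (e :* f :- s :* t) :+ h :* (e :* f :- s :* t)
                              := h :* ((e :- s) :* (f :+ t) :+ (e :+ s) :* (f :- t)) :- h :* :0) refl ½ e f s t))
    where
    e-s : 0# < e - s
    e-s = <⇒0<- q
    f-t : 0# < f - t
    f-t = <⇒0<- q′
    e+s : 0# < e + s
    e+s = by-< p (solve 2 (λ e s → e :+ s :- :0 := s :- :- e) refl e s)
    f+t : 0# < f + t
    f+t = by-< p′ (solve 2 (λ e s → e :+ s :- :0 := s :- :- e) refl f t)

  bound : ∀ x → Σ[ K ∈ ℝ ] (0# < K × Within K x)
  bound x with ≤-total 0# x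
  ... | inj₁ 0≤x = x + 1# , subst (0# <_) (+-comm 1# x) (+-pos 0<1 0≤x) ,
        by-< (+-pos 0<1 (+-nonneg 0≤x 0≤x)) (solve 1 (λ x → x :- :- (x :+ :1) := :1 :+ (x :+ x) :- :0) refl x) ,
        by-< 0<1 (solve 1 (λ x → x :+ :1 :- x := :1 :- :0) refl x)
  ... | inj₂ x≤0 = 1# - x , +-pos 0<1 0≤-x ,
        by-< 0<1 (solve 1 (λ x → x :- :- (:1 :- x) := :1 :- :0) refl x) ,
        by-< (+-pos 0<1 (+-nonneg 0≤-x 0≤-x)) (solve 1 (λ x → :1 :- x :- x := :1 :+ (:- x :+ :- x) :- :0) refl x)
    where
    0≤-x : 0# ≤ - x
    0≤-x = by-≤ x≤0 (solve 1 (λ x → :- x :- :0 := :0 :- x) refl x)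

  Eventually : (ℕ → Set) → Set
  Eventually P = Σ[ N ∈ ℕ ] (∀ n → N ℕ.≤ n → P n)

  eventually-map : ∀ {P Q : ℕ → Set} → (∀ n → P n → Q n) → Eventually P → Eventually Q
  eventually-map f (N , p) = N , λ n N≤n → f n (p n N≤n)

  eventually-map₂ : ∀ {P Q S : ℕ → Set} → (∀ n → P n → Q n → S n) →
                    Eventually P → Eventually Q → Eventually S
  eventually-map₂ f (M , p) (N , q) = M ℕ.⊔ N , λ n le →
    f n (p n (ℕ.≤-trans (ℕ.m≤m⊔n M N) le)) (q n (ℕ.≤-trans (ℕ.m≤n⊔m M N) le))

  const-converges : ∀ c → ConvergesTo (λ _ → c) c
  const-converges c ε 0<ε = 0 , λ _ _ →
    by-< 0<ε (solve 2 (λ c e → c :- (c :- e) := e :- :0) refl c ε) ,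
    by-< 0<ε (solve 2 (λ c e → c :+ e :- c := e :- :0) refl c ε)

  +-converges : ∀ {s t l m} → ConvergesTo s l → ConvergesTo t m → ConvergesTo (λ n → s n + t n) (l + m)
  +-converges {s} {t} {l} {m} sl tm ε 0<ε =
    eventually-map₂ (λ n p q → within⇒between (subst₂ Within (halves ε)
        (solve 4 (λ s t l m → (s :- l) :+ (t :- m) := s :+ t :- (l :+ m)) refl (s n) (t n) l m)
        (within-+ (between⇒within p) (between⇒within q))))
      (sl (½ * ε) 0<½ε) (tm (½ * ε) 0<½ε)
    where
    0<½ε : 0# < ½ * ε
    0<½ε = *-pos 0<½ 0<ε

  *-converges : ∀ {s t l m} → ConvergesTo s l → ConvergesTo t m → ConvergesTo (λ n → s n * t n) (l * m)
  *-converges {s} {t} {l} {m} sl tm ε 0<ε with bound l | bound m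
  ... | K , 0<K , l∈K | M , 0<M , m∈M =
    eventually-map₂ (λ n p q → within⇒between (subst₂ Within scale (split n)
        (within-+ (within-* (between⇒within p) (t∈M+1 n (proj₁ q))) (within-* l∈K (between⇒within (proj₂ q))))))
      (sl e (/-pos 0<½ε 0<M+1)) (eventually-map₂ (λ _ → _,_) (tm 1# 0<1) (tm f (/-pos 0<½ε 0<K)))
    where
    0<½ε : 0# < ½ * ε
    0<½ε = *-pos 0<½ 0<ε
    0<M+1 : 0# < M + 1#
    0<M+1 = +-pos 0<M 0≤1
    e f : ℝ
    e = ½ * ε / (M + 1#)
    f = ½ * ε / K
    t∈M+1 : ∀ n → Between (m - 1#) (m + 1#) (t n) → Within (M + 1#) (t n)
    t∈M+1 n p = subst (Within (M + 1#))
        (solve 2 (λ m t → m :+ (t :- m) := t) refl m (t n)) (within-+ m∈M (between⇒within p))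
    scale : e * (M + 1#) + K * f ≡ ε
    scale = trans (cong₂ _+_ (trans (*-comm e (M + 1#)) (*-/-cancel (½ * ε) 0<M+1)) (*-/-cancel (½ * ε) 0<K)) (halves ε)
    split : ∀ n → (s n - l) * t n + l * (t n - m) ≡ s n * t n - l * m
    split n = solve 4 (λ s t l m → (s :- l) :* t :+ l :* (t :- m) := s :* t :- l :* m) refl (s n) (t n) l m

  limit-≤ : ∀ {s t l m} → ConvergesTo s l → ConvergesTo t m → Eventually (λ n → s n ≤ t n) → l ≤ m
  limit-≤ {s} {t} {l} {m} sl tm s≤t = ≮⇒≥ λ m<l →
    absurd (eventually-map₂ (λ _ p s≤t → contra (proj₁ (proj₁ p)) s≤t (proj₂ (proj₂ p)))
      (eventually-map₂ (λ _ → _,_) (sl h (*-pos 0<½ (<⇒0<- m<l))) (tm h (*-pos 0<½ (<⇒0<- m<l)))) s≤t)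
    where
    h : ℝ
    h = ½ * (l - m)
    contra : ∀ {x y} → l - h < x → x ≤ y → ¬ y < m + h
    contra {x} l-h<x x≤y y<m+h = <-irrefl (subst (_< m + h) (midpoint l m) (<-trans (<-≤-trans l-h<x x≤y) y<m+h))
    absurd : ¬ Eventually (λ _ → ⊥)
    absurd (N , p) = p N ℕ.≤-refl

  ·-mono : ∀ {m n} → m ℕ.≤ n → m · 1# ≤ n · 1#
  ·-mono {n = zero}  ℕ.z≤n       = ≤-refl
  ·-mono {n = suc n} ℕ.z≤n       = <⇒≤ (·-suc-pos n)
  ·-mono             (ℕ.s≤s m≤n) = ≤-refl ⊕ ·-mono m≤n

  <-suc· : ∀ n → n · 1# < suc n · 1#
  <-suc· n = by-< 0<1 (solve 1 (λ x → :1 :+ x :- x := :1 :- :0) refl (n · 1#))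

  1/n-converges : ConvergesTo (λ n → (suc n · 1#) ⁻¹) 0#
  1/n-converges ε 0<ε with archimedean (ε ⁻¹)
  ... | N , ε⁻¹≤N = N , λ n N≤n → within⇒between (
        by-< (+-pos (⁻¹-pos (·-suc-pos n)) (<⇒≤ 0<ε))
            (solve 2 (λ x e → x :- :0 :- :- e := x :+ e :- :0) refl ((suc n · 1#) ⁻¹) ε) ,
        by-< (small n N≤n) (solve 2 (λ x e → e :- (x :- :0) := e :- x) refl ((suc n · 1#) ⁻¹) ε))
    where
    small : ∀ n → N ℕ.≤ n → (suc n · 1#) ⁻¹ < ε
    small n N≤n = subst₂ _<_ (trans (solve 3 (λ x e y → x :* e :* y := x :* (e :* y)) refl x ε (ε ⁻¹))
        (trans (cong (x *_) (inverse 0<ε)) (solve 1 (λ x → x :* :1 := x) refl x)))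
        (trans (solve 3 (λ x e y → x :* e :* y := e :* (y :* x)) refl x ε (suc n · 1#))
            (trans (cong (ε *_) (inverse (·-suc-pos n))) (solve 1 (λ x → x :* :1 := x) refl ε)))
        (*-pos (⁻¹-pos (·-suc-pos n)) 0<ε ⊛< ≤-<-trans ε⁻¹≤N (≤-<-trans (·-mono N≤n) (<-suc· n)))
      where
      x = (suc n · 1#) ⁻¹

-- The exponential: tangent inequality, positivity, monotonicity.

module ExponentialProperties (R : CompleteOrderedField) (E : ExpLog R) where
  open OrderedField R
  open Limits R
  open ExpLog E

  ^-nonneg : ∀ {x} → 0# ≤ x → ∀ n → 0# ≤ x ^ n
  ^-nonneg 0≤x zero    = 0≤1
  ^-nonneg 0≤x (suc n) = *-nonneg _ _ 0≤x (^-nonneg 0≤x n)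

  1^ : ∀ n → 1# ^ n ≡ 1#
  1^ zero    = refl
  1^ (suc n) = trans (*-identityˡ _) (1^ n)

  0≤· : ∀ n → 0# ≤ n · 1#
  0≤· n = ·-mono {0} {n} ℕ.z≤n

  -- Bernoulli's inequality for (p + d) / p, multiplied by pⁿ⁺¹.
  bernoulli : ∀ {p d} → 0# ≤ p → 0# ≤ p + d → ∀ n → p ^ n * (p + (n · 1#) * d) ≤ p * (p + d) ^ n
  bernoulli {p} {d} 0≤p 0≤q zero    = ≤-reflexive (solve 2 (λ p d → :1 :* (p :+ :0 :* d) := p :* :1) refl p d)
  bernoulli {p} {d} 0≤p 0≤q (suc n) = ≤-trans
    (by-≤ (*-nonneg _ _ (^-nonneg 0≤p n) (*-nonneg _ _ (0≤· n) 0≤d²))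
      (solve 4 (λ p d k x → (p :+ d) :* (x :* (p :+ k :* d)) :- (p :* x) :* (p :+ (:1 :+ k) :* d)
                            := x :* (k :* (d :* d)) :- :0) refl p d (n · 1#) (p ^ n)))
    (≤-trans (0≤q ⊛ bernoulli 0≤p 0≤q n)
      (≤-reflexive (solve 3 (λ p q y → q :* (p :* y) := p :* (q :* y)) refl p (p + d) ((p + d) ^ n))))
    where
    0≤d² : 0# ≤ d * d
    0≤d² with ≤-total 0# d
    ... | inj₁ 0≤d = *-nonneg _ _ 0≤d 0≤d
    ... | inj₂ d≤0 = subst (0# ≤_) (solve 1 (λ d → (:0 :- d) :* (:0 :- d) := d :* d) refl d)
                       (*-nonneg _ _ (≤⇒0≤- d≤0) (≤⇒0≤- d≤0))

  base : ℝ → ℕ → ℝ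
  base x n = 1# + x / (suc n · 1#)

  base-converges : ∀ x → ConvergesTo (base x) 1#
  base-converges x = subst (ConvergesTo (base x)) (solve 1 (λ x → :1 :+ x :* :0 := :1) refl x)
    (+-converges (const-converges 1#) (*-converges (const-converges x) 1/n-converges))

  0≤base : ∀ x → Eventually (λ n → 0# ≤ base x n)
  0≤base x = eventually-map (λ n p → subst (_≤ base x n) (solve 0 (:1 :- :1 := :0) refl) (<⇒≤ (proj₁ p)))
                            (base-converges x 1# 0<1)

  exp-0 : exp 0# ≡ 1#
  exp-0 = ≤-antisym (limit-≤ (exp-limit 0#) (const-converges 1#) (0 , λ n _ → ≤-reflexive (terms n)))
                    (limit-≤ (const-converges 1#) (exp-limit 0#) (0 , λ n _ → ≤-reflexive (sym (terms n))))
    where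
    terms : ∀ n → base 0# n ^ suc n ≡ 1#
    terms n = trans (cong (_^ suc n) (solve 1 (λ x → :1 :+ :0 :* x := :1) refl ((suc n · 1#) ⁻¹))) (1^ (suc n))

  -- Apply `bernoulli` to p = 1 + a / (n + 1) and d = u / (n + 1) with exponent n + 1, so that the
  -- multiple of d is u. The surplus p on either side tends to 1. Negative u is allowed, which later
  -- gives bounds from the right end of a step.
  exp-tangent : ∀ a u → exp a * (1# + u) ≤ exp (a + u)
  exp-tangent a u = subst (exp a * (1# + u) ≤_) (*-identityˡ _)
    (limit-≤ (*-converges (exp-limit a) (+-converges (base-converges a) (const-converges u)))
             (*-converges (base-converges a) (exp-limit (a + u)))
             (eventually-map₂ step (0≤base a) (0≤base (a + u))))
    where
    step : ∀ n → 0# ≤ base a n → 0# ≤ base (a + u) n →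
           base a n ^ suc n * (base a n + u) ≤ base a n * base (a + u) n ^ suc n
    step n 0≤p 0≤q = subst₂ _≤_ (cong (λ x → base a n ^ suc n * (base a n + x)) (*-/-cancel u (·-suc-pos n)))
                                (cong (λ x → base a n * x ^ suc n) (sym q≡))
                       (bernoulli 0≤p (subst (0# ≤_) q≡ 0≤q) (suc n))
      where
      q≡ : base (a + u) n ≡ base a n + u / (suc n · 1#)
      q≡ = solve 3 (λ a u x → :1 :+ (a :+ u) :* x := :1 :+ a :* x :+ u :* x) refl a u ((suc n · 1#) ⁻¹)

  exp-tangent-at : ∀ a b → exp a * (1# + (b - a)) ≤ exp b
  exp-tangent-at a b = subst (λ x → exp a * (1# + (b - a)) ≤ exp x)
    (solve 2 (λ a b → a :+ (b :- a) := b) refl a b) (exp-tangent a (b - a))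

  exp-≥ : ∀ x → 1# + x ≤ exp x
  exp-≥ x = subst₂ _≤_ (trans (cong (_* (1# + x)) exp-0) (*-identityˡ _)) (cong exp (+-identityˡ x)) (exp-tangent 0# x)

  -- The tangent step u = - ½ gives exp x ≥ ½ exp (x + ½), so positivity descends by half steps from
  -- x ≥ 0, where exp x ≥ 1 + x.
  exp-pos : ∀ x → 0# < exp x
  exp-pos x with archimedean (- x * 2#)
  ... | n , p = go n x (by-≤ (<⇒≤ 0<½ ⊛ p) (trans
          (cong (λ y → (n · 1#) * ½ - y) (trans (sym (halves (- x)))
              (solve 2 (λ h x → h :* (:- x) :+ h :* (:- x) := h :* (:- x :* (:1 :+ :1))) refl ½ x)))
          (cong (λ y → y - ½ * (- x * 2#)) (*-comm (n · 1#) ½))))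
    where
    go : ∀ n x → - x ≤ (n · 1#) * ½ → 0# < exp x
    go zero x -x≤0 = <-≤-trans (+-pos 0<1 (by-≤ -x≤0 (solve 2 (λ x h → x :- :0 := :0 :* h :- :- x) refl x ½))) (exp-≥ x)
    go (suc n) x -x≤ = <-≤-trans (*-pos (go n (x + ½)
        (by-≤ -x≤ (solve 3 (λ k x h → k :* h :- :- (x :+ h) := (:1 :+ k) :* h :- :- x) refl (n · 1#) x ½))) 0<½)
      (subst₂ _≤_ (cong (exp (x + ½) *_) 1-½) (cong exp (solve 2 (λ x h → x :+ h :+ :- h := x) refl x ½))
          (exp-tangent (x + ½) (- ½)))
      where
      1-½ : 1# + - ½ ≡ ½
      1-½ = trans (cong (_+ - ½) (sym ½+½)) (solve 1 (λ h → h :+ h :+ :- h := h) refl ½)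

  exp-strictMono : ∀ {x y} → x < y → exp x < exp y
  exp-strictMono {x} {y} x<y = <-≤-trans
    (by-< (*-pos (exp-pos x) (<⇒0<- x<y))
        (solve 3 (λ e x y → e :* (:1 :+ (y :- x)) :- e := e :* (y :- x) :- :0) refl (exp x) x y))
    (exp-tangent-at x y)

  exp-mono : ∀ {x y} → x ≤ y → exp x ≤ exp y
  exp-mono {x} {y} x≤y with x ≟ y
  ... | yes refl = ≤-refl
  ... | no x≢y   = <⇒≤ (exp-strictMono (x≤y , x≢y))

-- Offline optima and runs of an online algorithm.

module Offline (R : CompleteOrderedField) (E : ExpLog R) (L U : CompleteOrderedField.ℝ R) where
  open OrderedField R
  open Knapsack R E L U

  density*weight : ∀ i → density i * weight i ≡ value i
  density*weight i = trans (*-comm (density i) (weight i)) (*-/-cancel (value i) (weight-pos i))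

  if-nonneg : ∀ x {v} → 0# ≤ v → 0# ≤ (if x then v else 0#)
  if-nonneg true  0≤v = 0≤v
  if-nonneg false _   = ≤-refl

  totalValue-nonneg : ∀ {n} (is : Instance n) xs → 0# ≤ totalValue is xs
  totalValue-nonneg []       []       = ≤-refl
  totalValue-nonneg (i ∷ is) (x ∷ xs) = +-nonneg (if-nonneg x (<⇒≤ (value-pos i))) (totalValue-nonneg is xs)

  BestAmong : ∀ {n} → (Decisions n → Set) → (Decisions n → ℝ) → Set
  BestAmong {n} P f = Σ[ xs ∈ Decisions n ] (P xs × (∀ ys → P ys → f ys ≤ f xs))

  -- `IsOfflineOptimum` asks for a witness, so a maximiser is found by exhaustive branching on the
  -- first decision; the left alternative records a branch without any vector satisfying `P`.
  best : ∀ n {P : Decisions n → Set} (P? : ∀ xs → Dec (P xs)) (f : Decisions n → ℝ) →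
         (∀ xs → ¬ P xs) ⊎ BestAmong P f
  best zero P? f with P? []
  ... | yes p = inj₂ ([] , p , λ { [] _ → ≤-refl })
  ... | no ¬p = inj₁ λ { [] p → ¬p p }
  best (suc n) {P} P? f = compare (best n (λ xs → P? (true ∷ xs)) (λ xs → f (true ∷ xs)))
                                  (best n (λ xs → P? (false ∷ xs)) (λ xs → f (false ∷ xs)))
    where
    compare : (∀ xs → ¬ P (true ∷ xs)) ⊎ BestAmong (λ xs → P (true ∷ xs)) (λ xs → f (true ∷ xs)) →
              (∀ xs → ¬ P (false ∷ xs)) ⊎ BestAmong (λ xs → P (false ∷ xs)) (λ xs → f (false ∷ xs)) →
              (∀ xs → ¬ P xs) ⊎ BestAmong P f
    compare (inj₁ ¬t) (inj₁ ¬f) = inj₁ λ { (true ∷ xs) → ¬t xs ; (false ∷ xs) → ¬f xs }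
    compare (inj₁ ¬t) (inj₂ (xs , p , max)) = inj₂ (false ∷ xs , p ,
      λ { (true ∷ ys) q → ⊥-elim (¬t ys q) ; (false ∷ ys) q → max ys q })
    compare (inj₂ (xs , p , max)) (inj₁ ¬f) = inj₂ (true ∷ xs , p ,
      λ { (true ∷ ys) q → max ys q ; (false ∷ ys) q → ⊥-elim (¬f ys q) })
    compare (inj₂ (xs , p , max)) (inj₂ (ys , q , max′)) = Sum.[
      (λ t≤f → inj₂ (false ∷ ys , q , λ { (true ∷ zs) r → ≤-trans (max zs r) t≤f ; (false ∷ zs) r → max′ zs r })) ,
      (λ f≤t → inj₂ (true ∷ xs , p , λ { (true ∷ zs) r → max zs r ; (false ∷ zs) r → ≤-trans (max′ zs r) f≤t })) ]′
      (≤-total (f (true ∷ xs)) (f (false ∷ ys)))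

  totalWeight-none : ∀ {n} (is : Instance n) → totalWeight is (replicate n false) ≡ 0#
  totalWeight-none []       = refl
  totalWeight-none (i ∷ is) = trans (+-identityˡ _) (totalWeight-none is)

  offlineOptimum : ∀ {n} (is : Instance n) → Σ[ o ∈ ℝ ] IsOfflineOptimum is o
  offlineOptimum {n} is with best n (λ xs → totalWeight is xs ≤? 1#) (totalValue is)
  ... | inj₁ none = ⊥-elim (none (replicate n false) (subst (_≤ 1#) (sym (totalWeight-none is)) 0≤1))
  ... | inj₂ (xs , feasible , max) = totalValue is xs , (xs , feasible , refl) , max

  module Run (A : OnlineAlgorithm) where

    earned : History → ∀ {n} → Instance n → ℝ
    earned hist is = totalValue is (runFrom A hist is)

    earned-accept : ∀ {n} hist i (is : Instance n) → A hist i ≡ true →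
                    earned hist (i ∷ is) ≡ value i + earned ((i , true) ∷ hist) is
    earned-accept hist i is eq rewrite eq = refl

    earned-reject : ∀ {n} hist i (is : Instance n) → A hist i ≡ false →
                    earned hist (i ∷ is) ≡ earned ((i , false) ∷ hist) is
    earned-reject hist i is eq rewrite eq = +-identityˡ _

    earned-nonneg : ∀ hist {n} (is : Instance n) → 0# ≤ earned hist is
    earned-nonneg hist is = totalValue-nonneg is (runFrom A hist is)

    finalUtilization : History → ∀ {n} → Instance n → ℝ
    finalUtilization hist []       = utilization hist
    finalUtilization hist (i ∷ is) = finalUtilization ((i , A hist i) ∷ hist) is

    utilization-step : ∀ hist i x → utilization hist ≤ utilization ((i , x) ∷ hist)
    utilization-step hist i x = by-≤ (if-nonneg x (<⇒≤ (weight-pos i)))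
      (solve 2 (λ z w → z :+ w :- z := w :- :0) refl (utilization hist) (if x then weight i else 0#))

    utilization≤final : ∀ hist {n} (is : Instance n) → utilization hist ≤ finalUtilization hist is
    utilization≤final hist []       = ≤-refl
    utilization≤final hist (i ∷ is) =
        ≤-trans (utilization-step hist i (A hist i)) (utilization≤final ((i , A hist i) ∷ hist) is)

-- Parameters of the threshold.

module Parameters (R : CompleteOrderedField) (E : ExpLog R) (L U : CompleteOrderedField.ℝ R)
                  (0<L : CompleteOrderedField._<_ R (CompleteOrderedField.0# R) L)
                  (L<U : CompleteOrderedField._<_ R L U) where
  open OrderedField R
  open Limits R
  open ExponentialProperties R E
  open ExpLog E
  open Knapsack R E L U
  open Offline R E L U

  0<U : 0# < U
  0<U = <-trans 0<L L<U

  L*γ≡U : L * γ ≡ U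
  L*γ≡U = *-/-cancel U 0<L

  1<γ : 1# < γ
  1<γ = ≰⇒> λ γ≤1 → <⇒≱ L<U (subst₂ _≤_ L*γ≡U (solve 1 (λ x → x :* :1 := x) refl L) (<⇒≤ 0<L ⊛ γ≤1))

  0<γ : 0# < γ
  0<γ = <-trans 0<1 1<γ

  exp-lnγ : exp (ln γ) ≡ γ
  exp-lnγ = exp-ln γ 0<γ

  0<lnγ : 0# < ln γ
  0<lnγ = ≰⇒> λ lnγ≤0 → <⇒≱ 1<γ (subst₂ _≤_ exp-lnγ exp-0 (exp-mono lnγ≤0))

  0<lnγ+1 : 0# < ln γ + 1#
  0<lnγ+1 = +-pos 0<lnγ 0≤1

  0<T : 0# < T
  0<T = /-pos 0<1 0<lnγ+1

  -- This is T (ln γ + 1) = 1 rearranged. It makes the exponent α (z / T - 1) equal to α ln γ at z =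
  -- 1.
  T*lnγ≡1-T : T * ln γ ≡ 1# - T
  T*lnγ≡1-T = trans (solve 2 (λ t l → t :* l := (l :+ :1) :* t :- t) refl T (ln γ))
                    (cong (_- T) (*-/-cancel 1# 0<lnγ+1))

  T<1 : T < 1#
  T<1 = by-< (*-pos 0<T 0<lnγ) (trans (sym T*lnγ≡1-T) (solve 1 (λ x → x := x :- :0) refl (T * ln γ)))

  degradation-if : ∀ {α b} → does (1# ≤? α) ≡ b →
                   degradationFormula α ≡ (if b then α * γ / (α + γ - 1#) else α * γ / (α + γ ^ʳ α - 1#))
  degradation-if refl = refl

  -- L · exp h is the price at which the threshold of OKP-Alg(α) stops rising:
  -- either it reaches U, or the knapsack is full.
  record StopsAt (α h : ℝ) : Set where
    field
      h≤lnγ   : h ≤ ln γ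
      h≤α*lnγ : h ≤ α * ln γ
      tight   : h ≡ ln γ ⊎ h ≡ α * ln γ
      0<h     : 0# < h
      formula : degradationFormula α ≡ α * γ / (α + exp h - 1#)
      -- Equivalent to D ≥ 1: no α beats the baseline.
      bound-α : α + exp h - 1# ≤ α * γ

  stop : ∀ α → 0# < α → Σ[ h ∈ ℝ ] StopsAt α h
  stop α 0<α with 1# ≤? α
  ... | yes 1≤α = ln γ , record
    { h≤lnγ   = ≤-refl
    ; h≤α*lnγ = by-≤ (*-nonneg _ _ (≤⇒0≤- 1≤α) (<⇒≤ 0<lnγ))
        (solve 2 (λ a l → a :* l :- l := (a :- :1) :* l :- :0) refl α (ln γ))
    ; tight   = inj₁ refl
    ; 0<h     = 0<lnγ
    ; formula = trans (degradation-if (dec-true (1# ≤? α) 1≤α)) (cong (λ x → α * γ / (α + x - 1#)) (sym exp-lnγ))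
    ; bound-α = subst (λ x → α + x - 1# ≤ α * γ) (sym exp-lnγ)
        (by-≤ (*-nonneg _ _ (≤⇒0≤- 1≤α) (≤⇒0≤- (<⇒≤ 1<γ)))
          (solve 2 (λ a x → a :* x :- (a :+ x :- :1) := (a :- :1) :* (x :- :1) :- :0) refl α γ))
    }
  ... | no 1≰α = α * ln γ , record
    { h≤lnγ   = by-≤ (*-nonneg _ _ (≤⇒0≤- α≤1) (<⇒≤ 0<lnγ))
        (solve 2 (λ a l → l :- a :* l := (:1 :- a) :* l :- :0) refl α (ln γ))
    ; h≤α*lnγ = ≤-refl
    ; tight   = inj₂ refl
    ; 0<h     = *-pos 0<α 0<lnγ
    ; formula = degradation-if (dec-false (1# ≤? α) 1≰α)
    -- Convexity: the tangent of exp at α ln γ, evaluated at ln γ and at 0 with weights α and 1 - α,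
    -- gives γ^α ≤ α γ + 1 - α.
    ; bound-α = by-≤ (<⇒≤ 0<α ⊛ at-lnγ ⊕ ≤⇒0≤- α≤1 ⊛ at-0)
        (solve 4 (λ a l g x → a :* g :- (a :+ x :- :1)
                    := a :* g :+ (:1 :- a) :* :1 :- (a :* (x :* (:1 :+ (l :- a :* l))) :+ (:1 :- a) :* (x :* (:1 :+ (:0 :- a :* l)))))
          refl α (ln γ) γ (exp (α * ln γ)))
    }
    where
    α≤1 : α ≤ 1#
    α≤1 = <⇒≤ (≰⇒> 1≰α)
    at-lnγ : exp (α * ln γ) * (1# + (ln γ - α * ln γ)) ≤ γ
    at-lnγ = subst (exp (α * ln γ) * (1# + (ln γ - α * ln γ)) ≤_) exp-lnγ (exp-tangent-at (α * ln γ) (ln γ))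
    at-0 : exp (α * ln γ) * (1# + (0# - α * ln γ)) ≤ 1#
    at-0 = subst (exp (α * ln γ) * (1# + (0# - α * ln γ)) ≤_) exp-0 (exp-tangent-at (α * ln γ) 0#)

  -- Constants belonging to a fixed α.

  module Strategy (α : ℝ) (0<α : 0# < α) where

    h : ℝ
    h = proj₁ (stop α 0<α)

    open StopsAt (proj₂ (stop α 0<α)) public

    -- `κ` is the length over which the rising threshold grows by the factor e, `L * g` is the price
    -- at which it stops, and `c` is the competitive ratio to be established.
    D c κ B g : ℝ
    D = degradationFormula α
    c = D / T
    κ = T / α
    g = exp h
    -- The integral of the threshold over [0, z*].
    B = L * T + κ * (L * g - L)

    0<κ : 0# < κ
    0<κ = /-pos 0<T 0<α

    α*κ≡T : α * κ ≡ T
    α*κ≡T = *-/-cancel T 0<α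

    T*c≡D : T * c ≡ D
    T*c≡D = *-/-cancel D 0<T

    1<g : 1# < g
    1<g = subst (_< g) exp-0 (exp-strictMono 0<h)

    g≤γ : g ≤ γ
    g≤γ = subst (g ≤_) exp-lnγ (exp-mono h≤lnγ)

    L*g≤U : L * g ≤ U
    L*g≤U = subst (L * g ≤_) L*γ≡U (<⇒≤ 0<L ⊛ g≤γ)

    0<α+g-1 : 0# < α + g - 1#
    0<α+g-1 = by-< (0<α ⊕< <⇒≤ 1<g) (solve 2 (λ a g → a :+ g :- :1 :- :0 := a :+ g :- (:0 :+ :1)) refl α g)

    1≤D : 1# ≤ D
    1≤D = subst (1# ≤_) (sym formula)
      (*≤⇒≤/ 0<α+g-1 (subst (_≤ α * γ) (solve 1 (λ x → x := x :* :1) refl (α + g - 1#)) bound-α))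

    0<c : 0# < c
    0<c = /-pos (<-≤-trans 0<1 1≤D) 0<T

    1≤c : 1# ≤ c
    1≤c = ≤-trans 1≤D (subst₂ _≤_ (trans (*-comm c T) T*c≡D) (solve 1 (λ x → x :* :1 := x) refl c) (<⇒≤ 0<c ⊛ <⇒≤ T<1))

    -- Since κ = T / α, `B` equals (L T / α)(α + g - 1), whose last factor is the denominator of
    -- `D`; the product with D / T is L γ.
    c*B≡U : c * B ≡ U
    c*B≡U = *-cancelˡ-≡ 0<α (begin
      α * (c * (L * T + κ * (L * g - L)))       ≡⟨ solve 6 (λ a c l t k g → a :* (c :* (l :* t :+ k :* (l :* g :- l)))
                                                     := l :* ((t :* c) :* a :+ (a :* k) :* c :* (g :- :1))) refl α c L T κ g ⟩
      L * ((T * c) * α + (α * κ) * c * (g - 1#)) ≡⟨ cong₂ (λ x y → L * (x * α + y * c * (g - 1#))) T*c≡D α*κ≡T ⟩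
      L * (D * α + T * c * (g - 1#))             ≡⟨ cong (λ x → L * (D * α + x * (g - 1#))) T*c≡D ⟩
      L * (D * α + D * (g - 1#))                 ≡⟨ solve 4
          (λ l d a g → l :* (d :* a :+ d :* (g :- :1)) := l :* ((a :+ g :- :1) :* d)) refl L D α g ⟩
      L * ((α + g - 1#) * D)                     ≡⟨ cong (λ x → L * ((α + g - 1#) * x)) formula ⟩
      L * ((α + g - 1#) * (α * γ / (α + g - 1#))) ≡⟨ cong (L *_) (*-/-cancel (α * γ) 0<α+g-1) ⟩
      L * (α * γ)                                ≡⟨ solve 3 (λ l a g → l :* (a :* g) := a :* (l :* g)) refl L α γ ⟩
      α * (L * γ)                                ≡⟨ cong (α *_) L*γ≡U ⟩
      α * U                                      ∎)
      where open ≡-Reasoning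

    0<B : 0# < B
    0<B = +-pos (*-pos 0<L 0<T) (*-nonneg _ _ (<⇒≤ 0<κ) (≤⇒0≤- (by-≤ (<⇒≤ 0<L ⊛ <⇒≤ 1<g)
            (solve 2 (λ l g → l :* g :- l := l :* g :- l :* :1) refl L g))))

    -- The bound is affine in the price m, so it suffices to check it at L and U.
    price-bound : ∀ {m} → L ≤ m → m ≤ U → m ≤ c * (L * T + κ * (m - L))
    price-bound {m} L≤m m≤U = 0≤-⇒≤ (*-cancelˡ-≤ (<⇒0<- L<U) (subst₂ _≤_
        (solve 1 (λ x → :0 := x :* :0) refl (U - L))
        (solve 6 (λ l u t k c m → (u :- m) :* (c :* (l :* t) :- l) :+ (m :- l) :* (c :* (l :* t :+ k :* (u :- l)) :- u)
                  := (u :- l) :* (c :* (l :* t :+ k :* (m :- l)) :- m)) refl L U T κ c m)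
        (+-nonneg (*-nonneg _ _ (≤⇒0≤- m≤U) (≤⇒0≤- at-L)) (*-nonneg _ _ (≤⇒0≤- L≤m) (≤⇒0≤- at-U)))))
      where
      -- At m = L the claim is 1 ≤ D, because T c = D.
      at-L : L ≤ c * (L * T)
      at-L = subst₂ _≤_ (solve 1 (λ l → l :* :1 := l) refl L)
        (trans (cong (L *_) (sym T*c≡D)) (solve 3 (λ l t c → l :* (t :* c) := c :* (l :* t)) refl L T c)) (<⇒≤ 0<L ⊛ 1≤D)
      -- At m = U the right side is c B with `L * g` replaced by the larger `U`.
      at-U : U ≤ c * (L * T + κ * (U - L))
      at-U = subst (_≤ c * (L * T + κ * (U - L))) c*B≡U
        (<⇒≤ 0<c ⊛ (≤-refl ⊕ <⇒≤ 0<κ ⊛ by-≤ L*g≤U (solve 3 (λ l u x → u :- l :- (x :- l) := u :- x) refl L U (L * g))))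

    -- The price as a function of utilization, and its growth along a step.

    z* : ℝ
    z* = T + κ * h

    κ*α*lnγ≡1-T : κ * (α * ln γ) ≡ 1# - T
    κ*α*lnγ≡1-T = trans (solve 3 (λ k a l → k :* (a :* l) := (a :* k) :* l) refl κ α (ln γ))
        (trans (cong (_* ln γ) α*κ≡T) T*lnγ≡1-T)

    T+κ*α*lnγ≡1 : T + κ * (α * ln γ) ≡ 1#
    T+κ*α*lnγ≡1 = trans (cong (T +_) κ*α*lnγ≡1-T) (solve 1 (λ t → t :+ (:1 :- t) := :1) refl T)

    z*≤1 : z* ≤ 1#
    z*≤1 = subst (z* ≤_) T+κ*α*lnγ≡1 (≤-refl ⊕ <⇒≤ 0<κ ⊛ h≤α*lnγ)

    T≤z* : T ≤ z*
    T≤z* = by-≤ (*-nonneg _ _ (<⇒≤ 0<κ) (<⇒≤ 0<h)) (solve 2 (λ t x → t :+ x :- t := x :- :0) refl T (κ * h))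

    -- The positive part of z - T. It lets one formula cover the flat and the rising piece of the
    -- threshold, and the resulting `price` stays real valued at z = 1.
    excess : ℝ → ℝ
    excess z = z - min z T

    uncapped : ℝ → ℝ
    uncapped z = L * exp (κ ⁻¹ * excess z)

    price : ℝ → ℝ
    price z = min U (uncapped z)

    κ⁻¹ : ℝ
    κ⁻¹ = κ ⁻¹

    0≤κ⁻¹ : 0# ≤ κ⁻¹
    0≤κ⁻¹ = <⇒≤ (⁻¹-pos 0<κ)

    κ*κ⁻¹* : ∀ x → κ * (κ⁻¹ * x) ≡ x
    κ*κ⁻¹* x = trans (sym (*-assoc κ κ⁻¹ x)) (trans (cong (_* x) (inverse 0<κ)) (*-identityˡ x))

    κ⁻¹*κ* : ∀ x → κ⁻¹ * (κ * x) ≡ x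
    κ⁻¹*κ* x = trans (solve 3 (λ k i x → i :* (k :* x) := k :* (i :* x)) refl κ κ⁻¹ x) (κ*κ⁻¹* x)

    0≤excess : ∀ z → 0# ≤ excess z
    0≤excess z = ≤⇒0≤- (min-≤ˡ z T)

    L≤uncapped : ∀ z → L ≤ uncapped z
    L≤uncapped z = subst (_≤ uncapped z) (trans (cong (L *_) exp-0) (solve 1 (λ l → l :* :1 := l) refl L))
      (<⇒≤ 0<L ⊛ exp-mono (*-nonneg _ _ 0≤κ⁻¹ (0≤excess z)))

    L≤price : ∀ z → L ≤ price z
    L≤price z = min-glb (<⇒≤ L<U) (L≤uncapped z)

    price≤U : ∀ z → price z ≤ U
    price≤U z = min-≤ˡ U (uncapped z)

    0<price : ∀ z → 0# < price z
    0<price z = <-≤-trans 0<L (L≤price z)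

    excess-below : ∀ {z} → z ≤ T → excess z ≡ 0#
    excess-below {z} z≤T = trans (cong (λ x → z - x) (min-≤ z≤T)) (solve 1 (λ z → z :- z := :0) refl z)

    price-below : ∀ {z} → z ≤ T → price z ≡ L
    price-below {z} z≤T = ≤-antisym (≤-trans (min-≤ʳ U (uncapped z)) (≤-reflexive uncapped≡L)) (L≤price z)
      where
      uncapped≡L : uncapped z ≡ L
      uncapped≡L = trans (cong (λ x → L * exp (κ⁻¹ * x)) (excess-below z≤T))
        (trans (cong (λ x → L * exp x) (*-zeroʳ κ⁻¹)) (trans (cong (L *_) exp-0) (solve 1 (λ l → l :* :1 := l) refl L)))

    module _ {z w : ℝ} (0≤w : 0# ≤ w) where
      private
        -- The length of the part of the step from z to z + w that lies above `T`; `w - u` is the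
        -- length below.
        u : ℝ
        u = excess (z + w) - excess z

      z≤z+w : z ≤ z + w
      z≤z+w = by-≤ 0≤w (solve 2 (λ z w → z :+ w :- z := w :- :0) refl z w)

      0≤u : 0# ≤ u
      0≤u = ≤⇒0≤- (by-≤ (min-glb (by-≤ (min-≤ˡ (z + w) T)
          (solve 3 (λ m z w → z :- (m :- w) := z :+ w :- m) refl (min (z + w) T) z w))
                           (by-≤ (min-≤ʳ (z + w) T ⊕ 0≤w) (solve 3
                               (λ m t w → t :- (m :- w) := t :+ w :- (m :+ :0)) refl (min (z + w) T) T w)))
          (solve 4 (λ z w m m′ → z :+ w :- m′ :- (z :- m) := m :- (m′ :- w)) refl z w (min z T) (min (z + w) T)))

      0≤w-u : 0# ≤ w - u
      0≤w-u = by-≤ (min-glb {z + w} {T} (≤-trans (min-≤ˡ z T) z≤z+w) (min-≤ʳ z T))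
          (solve 4 (λ z w m m′ → w :- ((z :+ w :- m′) :- (z :- m)) :- :0 := m′ :- m) refl z w (min z T) (min (z + w) T))

      uncapped-tangent : uncapped z * (1# + κ⁻¹ * u) ≤ uncapped (z + w)
      uncapped-tangent = subst (_≤ uncapped (z + w))
        (solve 5 (λ l e k a b → l :* (e :* (:1 :+ (k :* b :- k :* a))) := (l :* e) :* (:1 :+ k :* (b :- a))) refl
          L (exp (κ⁻¹ * excess z)) κ⁻¹ (excess z) (excess (z + w)))
        (<⇒≤ 0<L ⊛ exp-tangent-at (κ⁻¹ * excess z) (κ⁻¹ * excess (z + w)))

      uncapped-tangent′ : uncapped (z + w) * (1# - κ⁻¹ * u) ≤ uncapped z
      uncapped-tangent′ = subst (_≤ uncapped z)
        (solve 5 (λ l e k a b → l :* (e :* (:1 :+ (k :* a :- k :* b))) := (l :* e) :* (:1 :- k :* (b :- a))) refl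
          L (exp (κ⁻¹ * excess (z + w))) κ⁻¹ (excess z) (excess (z + w)))
        (<⇒≤ 0<L ⊛ exp-tangent-at (κ⁻¹ * excess (z + w)) (κ⁻¹ * excess z))

      price-mono : price z ≤ price (z + w)
      price-mono = min-glb (min-≤ˡ _ _) (≤-trans (min-≤ʳ U (uncapped z))
        (<⇒≤ 0<L ⊛ exp-mono (0≤κ⁻¹ ⊛ by-≤ 0≤u
            (solve 2 (λ a b → b :- a := b :- a :- :0) refl (excess z) (excess (z + w))))))

      -- A discrete form of κ dm/dz ≤ m, with the tangent taken at the right end. The cap only slows
      -- the growth; passing from the price to `uncapped` under the factor 1 - u / κ requires that
      -- factor to be nonnegative, whence w ≤ κ.
      price-growth≤ : w ≤ κ → κ * (price (z + w) - price z) ≤ u * price (z + w)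
      price-growth≤ w≤κ = by-≤ (<⇒≤ 0<κ ⊛ scaled) (trans
          (cong (λ x → x * m′ - κ * (m′ - m)) (sym (κ*κ⁻¹* u)))
          (solve 5 (λ k i u m m′ → k :* (i :* u) :* m′ :- k :* (m′ :- m) := k :* m :- k :* ((:1 :- i :* u) :* m′)) refl κ κ⁻¹ u m m′))
        where
        m m′ : ℝ
        m  = price z
        m′ = price (z + w)
        κ⁻¹u≤1 : 0# ≤ 1# - κ⁻¹ * u
        κ⁻¹u≤1 = ≤⇒0≤- (subst (κ⁻¹ * u ≤_) (trans (*-comm κ⁻¹ κ) (inverse 0<κ))
                   (0≤κ⁻¹ ⊛ ≤-trans (0≤-⇒≤ 0≤w-u) w≤κ))
        scaled : (1# - κ⁻¹ * u) * m′ ≤ m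
        scaled = min-glb
          (≤-trans (by-≤ (*-nonneg _ _ (*-nonneg _ _ 0≤κ⁻¹ 0≤u) (<⇒≤ (0<price (z + w))))
                     (solve 2 (λ x m → m :- (:1 :- x) :* m := x :* m :- :0) refl (κ⁻¹ * u) m′)) (price≤U (z + w)))
          (≤-trans (κ⁻¹u≤1 ⊛ min-≤ʳ U (uncapped (z + w)))
            (subst (_≤ uncapped z) (*-comm (uncapped (z + w)) (1# - κ⁻¹ * u)) uncapped-tangent′))

      -- The tangent at the left end gives the reverse bound. A cap in force at the right end would
      -- stop the growth, hence the hypothesis.
      price-growth≥ : uncapped (z + w) ≤ U → u * price z ≤ κ * (price (z + w) - price z)
      price-growth≥ below = by-≤ (<⇒≤ 0<κ ⊛ scaled) (trans
          (cong (λ x → κ * (m′ - m) - x * m) (sym (κ*κ⁻¹* u)))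
          (solve 5 (λ k i u m m′ → k :* (m′ :- m) :- k :* (i :* u) :* m := k :* m′ :- k :* ((:1 :+ i :* u) :* m)) refl κ κ⁻¹ u m m′))
        where
        m m′ : ℝ
        m  = price z
        m′ = price (z + w)
        scaled : (1# + κ⁻¹ * u) * m ≤ m′
        scaled = ≤-trans (+-nonneg 0≤1 (*-nonneg _ _ 0≤κ⁻¹ 0≤u) ⊛ min-≤ʳ U (uncapped z))
          (subst₂ _≤_ (*-comm (uncapped z) (1# + κ⁻¹ * u)) (sym (min-≥ below)) uncapped-tangent)

    -- For δ = 0 and z ≤ z* this is the integral of the price over [0, z].
    potential : ℝ → ℝ → ℝ
    potential δ z = L * min z T + (κ - δ) * (price z - L)

    -- With m and m′ the prices before and after, `price-growth≤` gives κ (m′ - m) ≤ u m + u (m′ -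
    -- m). As u ≤ δ, lowering κ to κ - δ removes the last term. Over a run the loss telescopes to δ
    -- times the total rise of the price.
    potential-step≤ : ∀ {δ z w} → 0# ≤ w → w ≤ δ → δ ≤ κ → potential δ (z + w) ≤ potential δ z + price z * w
    potential-step≤ {δ} {z} {w} 0≤w w≤δ δ≤κ = by-≤
      (+-nonneg (*-nonneg _ _ (≤⇒0≤- (L≤price z)) (0≤w-u {z} 0≤w))
        (+-nonneg (≤⇒0≤- (price-growth≤ 0≤w (≤-trans w≤δ δ≤κ)))
          (*-nonneg _ _ (≤⇒0≤- (≤-trans (0≤-⇒≤ (0≤w-u {z} 0≤w)) w≤δ)) (≤⇒0≤- (price-mono 0≤w)))))
      (solve 9 (λ l k d z w a b m m′ →
          let u = (z :+ w :- b) :- (z :- a) in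
          (l :* a :+ (k :- d) :* (m :- l)) :+ m :* w :- (l :* b :+ (k :- d) :* (m′ :- l))
          := ((m :- l) :* (w :- u) :+ ((u :* m′ :- k :* (m′ :- m)) :+ (d :- u) :* (m′ :- m))) :- :0)
        refl L κ δ z w (min z T) (min (z + w) T) (price z) (price (z + w)))

    uncapped-z* : uncapped z* ≡ L * g
    uncapped-z* = cong (λ x → L * exp x) (trans
      (cong (κ⁻¹ *_) (trans (cong (λ x → z* - x) (min-≥ T≤z*)) (solve 2 (λ t x → t :+ x :- t := x) refl T (κ * h))))
      (κ⁻¹*κ* h))

    price-z* : price z* ≡ L * g
    price-z* = trans (cong (min U) uncapped-z*) (min-≥ L*g≤U)

    excess-mono : ∀ {x y} → x ≤ y → excess x ≤ excess y
    excess-mono {x} {y} x≤y = 0≤-⇒≤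
        (subst (λ t → 0# ≤ excess t - excess x) (solve 2 (λ x y → x :+ (y :- x) := y) refl x y) (0≤u {x} (≤⇒0≤- x≤y)))

    uncapped≤U : ∀ {z} → z ≤ z* → uncapped z ≤ U
    uncapped≤U z≤z* = ≤-trans (<⇒≤ 0<L ⊛ exp-mono (0≤κ⁻¹ ⊛ excess-mono z≤z*)) (≤-trans (≤-reflexive uncapped-z*) L*g≤U)

    -- A left Riemann sum of a nondecreasing price stays below the integral, so δ = 0 serves here;
    -- up to `z*` the cap is inactive.
    potential-step≥ : ∀ {z w} → 0# ≤ w → z + w ≤ z* → potential 0# z + price z * w ≤ potential 0# (z + w)
    potential-step≥ {z} {w} 0≤w z+w≤z* = by-≤
      (+-nonneg below-T (≤⇒0≤- (price-growth≥ {z} 0≤w (uncapped≤U z+w≤z*))))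
      (solve 8 (λ l k z w a b m m′ →
          let u = (z :+ w :- b) :- (z :- a) in
          (l :* b :+ (k :- :0) :* (m′ :- l)) :- (l :* a :+ (k :- :0) :* (m :- l) :+ m :* w)
          := ((l :- m) :* (w :- u) :+ (k :* (m′ :- m) :- u :* m)) :- :0)
        refl L κ z w (min z T) (min (z + w) T) (price z) (price (z + w)))
      where
      below-T : 0# ≤ (L - price z) * (w - (excess (z + w) - excess z))
      -- The product vanishes: either the price at z is still `L`, or no part of the step lies below
      -- `T`.
      below-T = Sum.[
        (λ z≤T → *-nonneg _ _ (≤⇒0≤- (≤-reflexive (price-below z≤T))) (0≤w-u {z} 0≤w)) ,
        (λ T≤z → ≤-reflexive (sym (begin
        (L - price z) * (w - ((z + w - min (z + w) T) - (z - min z T)))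
          ≡⟨ cong₂ (λ a b → (L - price z) * (w - ((z + w - a) - (z - b)))) (min-≥ (≤-trans T≤z (z≤z+w 0≤w))) (min-≥ T≤z) ⟩
        (L - price z) * (w - ((z + w - T) - (z - T)))
          ≡⟨ solve 4 (λ x z w t → x :* (w :- ((z :+ w :- t) :- (z :- t))) := :0) refl (L - price z) z w T ⟩
        0# ∎))) ]′ (≤-total z T)
        where open ≡-Reasoning

    potential-0 : ∀ δ → potential δ 0# ≡ 0#
    potential-0 δ = trans (cong₂ (λ x y → L * x + (κ - δ) * (y - L)) (min-≤ (<⇒≤ 0<T)) (price-below (<⇒≤ 0<T)))
      (solve 2 (λ l k → l :* :0 :+ k :* (l :- l) := :0) refl L (κ - δ))

    potential-z* : potential 0# z* ≡ B
    potential-z* = trans (cong₂ (λ x y → L * x + (κ - 0#) * (y - L)) (min-≥ T≤z*) price-z*)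
      (solve 4 (λ l t k g → l :* t :+ (k :- :0) :* (l :* g :- l) := l :* t :+ k :* (l :* g :- l)) refl L T κ g)

    potential-above : ∀ δ {z} → T ≤ z → potential δ z ≡ L * T + (κ - δ) * (price z - L)
    potential-above δ {z} T≤z = cong (λ x → L * x + (κ - δ) * (price z - L)) (min-≥ T≤z)

    -- The exponent of the uncapped threshold is α ln γ ≥ h at utilization 1 and smaller by δ / κ at
    -- 1 - δ; the tangent at h turns this loss into the factor 1 - δ / κ.
    price-near-1 : ∀ {δ z} → 0# ≤ δ → T ≤ z → 1# - δ ≤ z → L * g * (κ - δ) ≤ κ * price z
    price-near-1 {δ} {z} 0≤δ T≤z 1-δ≤z = subst (_≤ κ * price z)
        (trans (solve 4 (λ k x i d → k :* (x :* (:1 :- i :* d)) := x :* (k :- k :* (i :* d))) refl κ (L * g) κ⁻¹ δ)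
            (cong (λ x → L * g * (κ - x)) (κ*κ⁻¹* δ)))
        (<⇒≤ 0<κ ⊛ min-glb (≤-trans drop L*g≤U) rise)
      where
      drop : L * g * (1# - κ⁻¹ * δ) ≤ L * g
      drop = by-≤ (*-nonneg _ _ (*-nonneg _ _ (<⇒≤ 0<L) (<⇒≤ (<-trans 0<1 1<g))) (*-nonneg _ _ 0≤κ⁻¹ 0≤δ))
               (solve 2 (λ x y → x :- x :* (:1 :- y) := x :* y :- :0) refl (L * g) (κ⁻¹ * δ))
      exponent : h - κ⁻¹ * δ ≤ κ⁻¹ * excess z
      exponent = ≤-trans (h≤α*lnγ ⊕ ≤-refl {x = - (κ⁻¹ * δ)})
        (subst (_≤ κ⁻¹ * excess z) (trans
            (solve 3 (λ i x d → i :* (x :- d) := i :* x :- i :* d) refl κ⁻¹ (κ * (α * ln γ)) δ)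
                                         (cong (_- κ⁻¹ * δ) (κ⁻¹*κ* (α * ln γ))))
          (0≤κ⁻¹ ⊛ subst₂ _≤_ (trans (solve 2 (λ t d → :1 :- d :- t := :1 :- t :- d) refl T δ)
              (cong (_- δ) (sym κ*α*lnγ≡1-T))) (cong (λ x → z - x) (sym (min-≥ T≤z))) (1-δ≤z ⊕ ≤-refl {x = - T})))
      rise : L * g * (1# - κ⁻¹ * δ) ≤ uncapped z
      rise = ≤-trans (subst (_≤ L * exp (h - κ⁻¹ * δ))
          (solve 4 (λ l g h x → l :* (g :* (:1 :+ (h :- x :- h))) := l :* g :* (:1 :- x)) refl L g h (κ⁻¹ * δ))
          (<⇒≤ 0<L ⊛ exp-tangent-at h (h - κ⁻¹ * δ)))
        (<⇒≤ 0<L ⊛ exp-mono exponent)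

    -- Two errors of at most U δ each: the lowered coefficient of `potential` costs δ times the rise
    -- of the price, and `price-near-1` costs δ times `L * g`.
    slack : ℝ → ℝ
    slack δ = c * ((U + U) * δ)

    price≤spent : ∀ {δ z S} → 0# ≤ δ → T ≤ z → potential δ z ≤ S → price z ≤ c * S + slack δ
    price≤spent {δ} {z} {S} 0≤δ T≤z G≤S = ≤-trans (price-bound (L≤price z) (price≤U z))
      (by-≤ (<⇒≤ 0<c ⊛ (subst (_≤ S) (potential-above δ T≤z) G≤S ⊕ 0≤δ ⊛ (price≤U z ⊕ +-nonneg (<⇒≤ 0<L) (<⇒≤ 0<U))))
        (solve 8 (λ c s u d l t k m → c :* s :+ c :* ((u :+ u) :* d) :- c :* (l :* t :+ k :* (m :- l))
            := c :* (s :+ d :* (u :+ (l :+ u)))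
               :- c :* ((l :* t :+ (k :- d) :* (m :- l)) :+ d :* (m :+ :0)))
          refl c S U δ L T κ (price z)))

    -- `U` may exceed the last price, for instance when α < 1, so `price-bound` does not suffice.
    -- But near utilization 1 the potential is at least nearly `B`, and c B = U.
    U≤spent : ∀ {δ z S} → 0# ≤ δ → T ≤ z → 1# - δ ≤ z → potential δ z ≤ S → U ≤ c * S + slack δ
    U≤spent {δ} {z} {S} 0≤δ T≤z 1-δ≤z G≤S = subst (_≤ c * S + slack δ) c*B≡U
      (by-≤ (<⇒≤ 0<c ⊛ (subst (_≤ S) (potential-above δ T≤z) G≤S ⊕ price-near-1 0≤δ T≤z 1-δ≤z
                        ⊕ 0≤δ ⊛ (price≤U z ⊕ L*g≤U ⊕ (<⇒≤ 0<L))))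
        (solve 9 (λ c s u d l t k m g → c :* s :+ c :* ((u :+ u) :* d) :- c :* (l :* t :+ k :* (l :* g :- l))
            := c :* (s :+ (k :* m :+ d :* (u :+ (u :+ l))))
               :- c :* ((l :* t :+ (k :- d) :* (m :- l)) :+ (l :* g :* (k :- d) :+ d :* (m :+ (l :* g :+ :0)))))
          refl c S U δ L T κ (price z) g))

    -- The decisions of `OKP-Alg` in terms of the price.

    Ψ-if : ∀ {z a b} → does (z <? T) ≡ a → does (z <? 1#) ≡ b →
           Ψ α z ≡ (if a then [ L ] else if b then [ min U (L * exp (α * (z / T - 1#))) ] else ⊤⁺)
    Ψ-if refl refl = refl

    Ψ-below : ∀ {z} → z < 1# → Ψ α z ≡ [ price z ]
    Ψ-below {z} z<1 = by-cases (z <? T)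
      where
      open ≡-Reasoning
      exponent : α * (z / T - 1#) ≡ κ⁻¹ * (z - T)
      exponent = begin
        α * (z / T - 1#)                 ≡⟨ κ⁻¹*κ* _ ⟨
        κ⁻¹ * (κ * (α * (z / T - 1#)))   ≡⟨ cong (κ⁻¹ *_)
            (solve 3 (λ k a x → k :* (a :* (x :- :1)) := (a :* k) :* x :- a :* k) refl κ α (z / T)) ⟩
        κ⁻¹ * (α * κ * (z / T) - α * κ)  ≡⟨ cong (λ t → κ⁻¹ * (t * (z / T) - t)) α*κ≡T ⟩
        κ⁻¹ * (T * (z / T) - T)          ≡⟨ cong (λ x → κ⁻¹ * (x - T)) (*-/-cancel z 0<T) ⟩
        κ⁻¹ * (z - T)                    ∎
      by-cases : Dec (z < T) → Ψ α z ≡ [ price z ]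
      by-cases (yes z<T) = trans (Ψ-if (dec-true (z <? T) z<T) refl) (cong [_] (sym (price-below (<⇒≤ z<T))))
      by-cases (no z≮T)  = trans (Ψ-if (dec-false (z <? T) z≮T) (dec-true (z <? 1#) z<1))
          (cong (λ x → [ min U (L * exp x) ])
        (trans exponent (cong (λ x → κ⁻¹ * (z - x)) (sym (min-≥ (≮⇒≥ z≮T))))))

    open WithInfinity _≤_ using (_≤⁺_; [≤]-injective) renaming ([_] to ≤⇒≤⁺)

    module _ (hist : History) (i : Item) where
      private
        z w d : ℝ
        z = utilization hist
        w = weight i
        d = density i

      fits⇒below-1 : z + w ≤ 1# → z < 1#
      fits⇒below-1 z+w≤1 = <-≤-trans (by-< (weight-pos i) (solve 2 (λ z w → z :+ w :- z := w :- :0) refl z w)) z+w≤1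

      accepts : price z ≤ d → z + w ≤ 1# → OKP-Alg α hist i ≡ true
      accepts p≤d fits = cong₂ _∧_
        (dec-true (Ψ α z ≤⁺? [ d ]) (subst (_≤⁺ [ d ]) (sym (Ψ-below (fits⇒below-1 fits))) (≤⇒≤⁺ p≤d)))
        (dec-true (z + w ≤? 1#) fits)

      rejects-overweight : 1# < z + w → OKP-Alg α hist i ≡ false
      rejects-overweight over = trans
        (cong (does (Ψ α z ≤⁺? [ d ]) ∧_) (dec-false (z + w ≤? 1#) (<⇒≱ over))) (∧-zeroʳ _)

      -- `Ψ` equals the price only below utilization 1, and no bound on the utilization is known
      -- here. So capacity is tested first: an item that does not fit is rejected anyway, and one
      -- that fits has positive weight, so z < 1.
      rejects-cheap : d < price z → OKP-Alg α hist i ≡ false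
      rejects-cheap d<p = by-cases (z + w ≤? 1#)
        where
        by-cases : Dec (z + w ≤ 1#) → OKP-Alg α hist i ≡ false
        by-cases (no over)  = rejects-overweight (≰⇒> over)
        by-cases (yes fits) = cong (_∧ does (z + w ≤? 1#))
          (dec-false (Ψ α z ≤⁺? [ d ]) λ Ψ≤d →
              <⇒≱ d<p ([≤]-injective (subst (_≤⁺ [ d ]) (Ψ-below (fits⇒below-1 fits)) Ψ≤d)))

      Justified : Bool → Set
      Justified true  = price z ≤ d × z + w ≤ 1#
      Justified false = d < price z ⊎ 1# < z + w

      decision-justified : Justified (OKP-Alg α hist i)
      decision-justified = by-cases (price z ≤? d) (z + w ≤? 1#)
        where
        by-cases : Dec (price z ≤ d) → Dec (z + w ≤ 1#) → Justified (OKP-Alg α hist i)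
        by-cases (yes p≤d) (yes fits) = subst Justified (sym (accepts p≤d fits)) (p≤d , fits)
        by-cases (no p≰d)  _          = subst Justified (sym (rejects-cheap (≰⇒> p≰d))) (inj₁ (≰⇒> p≰d))
        by-cases (yes _)   (no over)  = subst Justified (sym (rejects-overweight (≰⇒> over))) (inj₂ (≰⇒> over))

    price-monotone : ∀ {x y} → x ≤ y → price x ≤ price y
    price-monotone {x} {y} x≤y = subst (λ t → price x ≤ price t)
        (solve 2 (λ x y → x :+ (y :- x) := y) refl x y) (price-mono (≤⇒0≤- x≤y))

    -- Upper bound by weak duality.

    module Accounting (A : OnlineAlgorithm) (justified : ∀ hist i → Justified hist i (A hist i))
                      (δ : ℝ) (δ≤κ : δ ≤ κ) where
      open Run A

      Admits : ∀ {n} → Instance n → Set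
      Admits = All (Admissible δ)

      spent : History → ∀ {n} → Instance n → ℝ
      spent hist []       = 0#
      spent hist (i ∷ is) = (if A hist i then price (utilization hist) * weight i else 0#) + spent ((i , A hist i) ∷ hist) is

      potential-growth : ∀ hist {n} {is : Instance n} → Admits is →
                         potential δ (finalUtilization hist is) ≤ potential δ (utilization hist) + spent hist is
      potential-growth hist {is = []}     []        = ≤-reflexive (sym (+-identityʳ _))
      potential-growth hist {is = i ∷ is} (ok ∷ oks) = ≤-trans (potential-growth ((i , A hist i) ∷ hist) oks)
        (by-≤ (step (A hist i)) (solve 4 (λ a b c d → a :+ (c :+ d) :- (b :+ d) := a :+ c :- b) refl
           (potential δ (utilization hist)) (potential δ (utilization ((i , A hist i) ∷ hist)))
           (if A hist i then price (utilization hist) * weight i else 0#) (spent ((i , A hist i) ∷ hist) is)))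
        where
        step : ∀ x → potential δ (utilization ((i , x) ∷ hist)) ≤
                     potential δ (utilization hist) + (if x then price (utilization hist) * weight i else 0#)
        step true  = potential-step≤ (<⇒≤ (weight-pos i)) (proj₂ (proj₂ ok)) δ≤κ
        step false = ≤-reflexive (trans (cong (potential δ) (+-identityʳ _)) (sym (+-identityʳ _)))

      paid : ∀ {p} i → p ≤ density i → p * weight i ≤ value i
      paid {p} i p≤d = subst₂ _≤_ (*-comm (weight i) p)
          (trans (*-comm (weight i) (density i)) (density*weight i)) (<⇒≤ (weight-pos i) ⊛ p≤d)

      underpaid : ∀ {p} i → density i ≤ p → value i ≤ p * weight i
      underpaid {p} i d≤p = subst₂ _≤_
          (trans (*-comm (weight i) (density i)) (density*weight i)) (*-comm (weight i) p) (<⇒≤ (weight-pos i) ⊛ d≤p)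

      spent≤value : ∀ hist {n} (is : Instance n) → spent hist is ≤ totalValue is (runFrom A hist is)
      spent≤value hist []       = ≤-refl
      spent≤value hist (i ∷ is) = item (A hist i) (justified hist i) ⊕ spent≤value ((i , A hist i) ∷ hist) is
        where
        item : ∀ x → Justified hist i x →
            (if x then price (utilization hist) * weight i else 0#) ≤ (if x then value i else 0#)
        item true  (p≤d , _) = paid i p≤d
        item false _         = ≤-refl

      -- Weak duality: p prices the capacity, and no rejected item is worth more than p per unit of weight.
      duality : ∀ hist {n} {is : Instance n} → Admits is → ∀ {p} → price (finalUtilization hist is) ≤ p →
                U ≤ p ⊎ finalUtilization hist is + δ ≤ 1# → ∀ xs →
                totalValue is xs + spent hist is ≤ p * totalWeight is xs + totalValue is (runFrom A hist is)
      duality hist {is = []} [] {p} _ _ [] = ≤-reflexive (solve 1 (λ p → :0 :+ :0 := p :* :0 :+ :0) refl p)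
      duality hist {is = i ∷ is} (ok ∷ oks) {p} final≤p room (x ∷ xs) =
        by-≤ (item x (A hist i) (justified hist i) ⊕ duality ((i , A hist i) ∷ hist) oks final≤p room xs)
          (solve 9 (λ p a b c d a′ b′ c′ d′ →
              p :* (c :+ c′) :+ (d :+ d′) :- ((a :+ a′) :+ (b :+ b′))
              := (p :* c :+ d) :+ (p :* c′ :+ d′) :- ((a :+ b) :+ (a′ :+ b′))) refl p
            (if x then value i else 0#) (if A hist i then price z * weight i else 0#)
            (if x then weight i else 0#) (if A hist i then value i else 0#)
            (totalValue is xs) (spent ((i , A hist i) ∷ hist) is) (totalWeight is xs) (totalValue is (runFrom A ((i , A hist i) ∷ hist) is)))
        where
        z : ℝ
        z = utilization hist
        z≤final : z ≤ finalUtilization hist (i ∷ is)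
        z≤final = utilization≤final hist (i ∷ is)
        price≤p : price z ≤ p
        price≤p = ≤-trans (price-monotone z≤final) final≤p
        0≤w : 0# ≤ weight i
        0≤w = <⇒≤ (weight-pos i)
        rejected : density i < price z ⊎ 1# < z + weight i → value i ≤ p * weight i
        rejected (inj₁ d<price) = underpaid i (≤-trans (<⇒≤ d<price) price≤p)
        -- A lack of room contradicts a spare capacity of δ at the end; otherwise p ≥ `U` is at
        -- least every density.
        rejected (inj₂ over) = Sum.[
          (λ U≤p → underpaid i (≤-trans (proj₁ (proj₂ ok)) U≤p)) ,
          (λ fits → ⊥-elim (<⇒≱ over (≤-trans (z≤final ⊕ proj₂ (proj₂ ok)) fits))) ]′ room
        item : ∀ x y → Justified hist i y →
               (if x then value i else 0#) + (if y then price z * weight i else 0#) ≤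
               p * (if x then weight i else 0#) + (if y then value i else 0#)
        item true  true  _ = by-≤ (0≤w ⊛ price≤p)
          (solve 4 (λ p m v w → p :* w :+ v :- (v :+ m :* w) := w :* p :- w :* m) refl p (price z) (value i) (weight i))
        item false true  (m≤d , _) = by-≤ (paid i m≤d)
          (solve 3 (λ p v x → p :* :0 :+ v :- (:0 :+ x) := v :- x) refl p (value i) (price z * weight i))
        item true  false r = by-≤ (rejected r)
          (solve 2 (λ x v → x :+ :0 :- (v :+ :0) := x :- v) refl (p * weight i) (value i))
        item false false _ = ≤-reflexive (solve 1 (λ p → :0 :+ :0 := p :* :0 :+ :0) refl p)

      below-T-optimal : T + δ ≤ 1# → ∀ hist {n} {is : Instance n} → Admits is → finalUtilization hist is < T →
                        ∀ xs → totalValue is xs ≤ totalValue is (runFrom A hist is)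
      below-T-optimal room hist {is = []}     []         _       []       = ≤-refl
      below-T-optimal room hist {is = i ∷ is} (ok ∷ oks) final<T (x ∷ xs) =
        item x (A hist i) (justified hist i) ⊕ below-T-optimal room ((i , A hist i) ∷ hist) oks final<T xs
        where
        z<T : utilization hist < T
        z<T = ≤-<-trans (utilization≤final hist (i ∷ is)) final<T
        item : ∀ x y → Justified hist i y → (if x then value i else 0#) ≤ (if y then value i else 0#)
        item true  true  _ = ≤-refl
        item false true  _ = <⇒≤ (value-pos i)
        item false false _ = ≤-refl
        item true  false (inj₁ d<price) =
            ⊥-elim (<⇒≱ d<price (subst (_≤ density i) (sym (price-below (<⇒≤ z<T))) (proj₁ ok)))
        item true  false (inj₂ over)    = ⊥-elim (<⇒≱ over (≤-trans (<⇒≤ z<T ⊕ proj₂ (proj₂ ok)) room))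

      ratio≤ : 0# < δ → T + δ ≤ 1# → ∀ {n} (is : Instance (suc n)) → Admits is → ∀ {o} → IsOfflineOptimum is o →
               o / algValue A is ≤ c + slack δ / (L * T)
      ratio≤ 0<δ room is@(i ∷ is′) oks {o} ((xs , feasible , value≡o) , _) = by-cases (final <? T)
        where
        final S V q : ℝ
        final = finalUtilization [] is
        S     = spent [] is
        V     = algValue A is
        q     = slack δ / (L * T)

        0<LT : 0# < L * T
        0<LT = *-pos 0<L 0<T

        0≤slack : 0# ≤ slack δ
        0≤slack = *-nonneg _ _ (<⇒≤ 0<c) (*-nonneg _ _ (+-nonneg (<⇒≤ 0<U) (<⇒≤ 0<U)) (<⇒≤ 0<δ))

        0≤q : 0# ≤ q
        0≤q = *-nonneg _ _ 0≤slack (<⇒≤ (⁻¹-pos 0<LT))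

        light : final < T → o / V ≤ c + q
        light final<T = ≤*⇒/≤ 0<V (≤-trans (subst (_≤ V) value≡o (optimal xs))
            (subst (_≤ V * (c + q)) (solve 1 (λ v → v :* (:1 :+ :0) := v) refl V) (<⇒≤ 0<V ⊛ (1≤c ⊕ 0≤q))))
          where
          optimal : ∀ ys → totalValue is ys ≤ V
          optimal = below-T-optimal room [] oks final<T
          0<V : 0# < V
          -- The selection of the first item alone already has positive value.
          0<V = <-≤-trans (+-pos (value-pos i) (totalValue-nonneg is′ (replicate _ false))) (optimal (true ∷ replicate _ false))

        module Heavy (T≤final : T ≤ final) where
          growth : potential δ final ≤ S
          growth = subst (potential δ final ≤_)
              (trans (cong (_+ S) (potential-0 δ)) (+-identityˡ S)) (potential-growth [] oks)

          -- A lower bound free of δ; it turns the additive error `slack δ` into the relative error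
          -- `q`.
          LT≤S : L * T ≤ S
          LT≤S = ≤-trans (by-≤ (*-nonneg _ _ (≤⇒0≤- δ≤κ) (≤⇒0≤- (L≤price final)))
                   (solve 2 (λ x y → x :+ y :- x := y :- :0) refl (L * T) ((κ - δ) * (price final - L))))
                 (subst (_≤ S) (potential-above δ T≤final) growth)

          S≤V : S ≤ V
          S≤V = spent≤value [] is

          LT≤V : L * T ≤ V
          LT≤V = ≤-trans LT≤S S≤V

          0<V : 0# < V
          0<V = <-≤-trans 0<LT LT≤V

          priced : ∀ {p} → price final ≤ p → U ≤ p ⊎ final + δ ≤ 1# → p ≤ c * S + slack δ → o / V ≤ c + q
          priced {p} final≤p free p≤ = ≤*⇒/≤ 0<V (subst (_≤ V * (c + q)) value≡o (≤-trans
            -- For an offline value t: t ≤ p + V - S ≤ V + (c - 1) S + slack ≤ c V + slack, the last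
            -- step by S ≤ V and c ≥ 1.
            (by-≤ (duality [] oks final≤p free xs ⊕ <⇒≤ (<-≤-trans (0<price final) final≤p) ⊛ feasible ⊕ p≤ ⊕ ≤⇒0≤- 1≤c ⊛ S≤V)
              (solve 7 (λ c v s k p t w → c :* v :+ k :- t
                  := (p :* w :+ v) :+ (p :* :1 :+ (c :* s :+ k :+ (c :- :1) :* v))
                     :- ((t :+ s) :+ (p :* w :+ (p :+ (c :- :1) :* s))))
                refl c V S (slack δ) p (totalValue is xs) (totalWeight is xs)))
            (subst₂ _≤_ (cong (c * V +_) (trans (*-comm q (L * T)) (*-/-cancel (slack δ) 0<LT)))
              (solve 3 (λ c v q → c :* v :+ q :* v := v :* (c :+ q)) refl c V q)
              (≤-refl {x = c * V} ⊕ 0≤q ⊛ LT≤V))))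

          bounded : Dec (1# - δ ≤ final) → o / V ≤ c + q
          -- Within δ of full, capacity may have caused rejections and p is raised to `U`; otherwise
          -- every item still fits and the final price serves.
          bounded (yes near) = priced (price≤U final) (inj₁ ≤-refl) (U≤spent (<⇒≤ 0<δ) T≤final near growth)
          bounded (no ¬near) = priced ≤-refl (inj₂
              (by-≤ (<⇒≤ (≰⇒> ¬near)) (solve 2 (λ z d → :1 :- (z :+ d) := :1 :- d :- z) refl final δ)))
                                 (price≤spent (<⇒≤ 0<δ) T≤final growth)

        by-cases : Dec (final < T) → o / V ≤ c + q
        by-cases (yes final<T) = light final<T
        by-cases (no final≮T)  = Heavy.bounded (≮⇒≥ final≮T) (1# - δ ≤? final)

    -- Lower bound by an adversarial instance.

    item : ∀ d w → 0# < d → 0# < w → Item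
    item d w 0<d 0<w = record { value = d * w ; weight = w ; value-pos = *-pos 0<d 0<w ; weight-pos = 0<w }

    density-item : ∀ {d w} 0<d 0<w → density (item d w 0<d 0<w) ≡ d
    density-item {d} {w} 0<d 0<w = trans (*-assoc d w (w ⁻¹))
        (trans (cong (d *_) (inverse 0<w)) (solve 1 (λ d → d :* :1 := d) refl d))

    0<z* : 0# < z*
    0<z* = <-≤-trans 0<T T≤z*

    -- Items of density `price z` lift the utilization from 0 to z*; then a
    -- knapsack full of items of density q < U arrives and is rejected.
    module Adversary (A : OnlineAlgorithm)
                     (accepts : ∀ hist i → price (utilization hist) ≤ density i → utilization hist + weight i ≤ 1# →
                         A hist i ≡ true)
                     (rejects-cheap : ∀ hist i → density i < price (utilization hist) → A hist i ≡ false)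
                     (rejects-overweight : ∀ hist i → 1# < utilization hist + weight i → A hist i ≡ false)
                     (N : ℕ) (0<ν : 0# < N · 1#) (q : ℝ) (L≤q : L ≤ q) (q<U : q < U) where
      open Run A

      -- N baits of weight z* / N end exactly at `z*`, and N prizes of weight 1 / N fill the
      -- capacity exactly. As z* ≤ 1, both weights are at most δ once N δ ≥ 1.
      ν w w′ : ℝ
      ν  = N · 1#
      w  = z* / ν
      w′ = 1# / ν

      0<w : 0# < w
      0<w = /-pos 0<z* 0<ν

      0<w′ : 0# < w′
      0<w′ = /-pos 0<1 0<ν

      0<q : 0# < q
      0<q = <-≤-trans 0<L L≤q

      -- The length is a variable `m`, so that its equation with `suc n` can be matched by `refl`;
      -- for the length N + N of the attack the match would be stuck.
      ratio-from : ∀ {m n δ} → m ≡ suc n → (is : Instance m) → All (Admissible δ) is →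
                   ∀ xs → Feasible is xs → q ≤ totalValue is xs → 0# < earned [] is → earned [] is ≤ B →
                   Σ[ r ∈ ℝ ] (PerformanceRatio A δ r × q / B ≤ r)
      ratio-from {n = n} {δ} refl is oks xs feasible q≤value 0<V V≤B = against (offlineOptimum is)
        where
        V : ℝ
        V = algValue A is
        against : Σ[ o ∈ ℝ ] IsOfflineOptimum is o → Σ[ r ∈ ℝ ] (PerformanceRatio A δ r × q / B ≤ r)
        against (o , isOptimum) = o / V , (n , is , oks , o , isOptimum , refl) , *≤⇒≤/ 0<V (≤-trans
          (subst₂ _≤_ (*-comm (q / B) V) (trans (*-comm (q / B) B) (*-/-cancel q 0<B)) (<⇒≤ (/-pos 0<q 0<B) ⊛ V≤B))
          (≤-trans q≤value (proj₂ isOptimum xs feasible)))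

      bait : ℝ → Item
      bait z = item (price z) w (0<price z) 0<w

      prize : Item
      prize = item q w′ 0<q 0<w′

      -- An instance cannot consult the history, so the utilization at which each bait is priced is
      -- carried along as `z`.
      attack : ∀ n → ℝ → Instance (n ℕ.+ N)
      attack zero    z = replicate N prize
      attack (suc n) z = bait z ∷ attack n (z + w)

      prize-rejected : ∀ hist → utilization hist ≡ z* → A hist prize ≡ false
      prize-rejected hist eq = Sum.[ at-U , at-1 ]′ tight
        where
        at-U : h ≡ ln γ → A hist prize ≡ false
        at-U h≡ = rejects-cheap hist prize (subst₂ _<_ (sym (density-item 0<q 0<w′)) (sym price≡U) q<U)
          where
          price≡U : price (utilization hist) ≡ U
          price≡U = trans (cong price eq) (trans price-z* (trans (cong (L *_) (trans (cong exp h≡) exp-lnγ)) L*γ≡U))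
        at-1 : h ≡ α * ln γ → A hist prize ≡ false
        at-1 h≡ = rejects-overweight hist prize (subst (λ x → 1# < x + w′)
            (sym (trans eq (trans (cong (λ x → T + κ * x) h≡) T+κ*α*lnγ≡1)))
            (by-< 0<w′ (solve 1 (λ w → :1 :+ w :- :1 := w :- :0) refl w′)))

      prizes-value : ∀ n hist → utilization hist ≡ z* → earned hist (replicate n prize) ≡ 0#
      prizes-value zero    hist eq = refl
      prizes-value (suc n) hist eq = trans (earned-reject hist prize (replicate n prize) (prize-rejected hist eq))
        (prizes-value n ((prize , false) ∷ hist) (trans (+-identityʳ _) eq))

      module _ (n : ℕ) (z : ℝ) (hist : History) (at-z : utilization hist ≡ z) (to-z* : z + (suc n · 1#) * w ≡ z*) where

        z+w≤z* : z + w ≤ z*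
        z+w≤z* = subst (z + w ≤_) to-z* (by-≤ (*-nonneg _ _ (·-mono {0} {n} ℕ.z≤n) (<⇒≤ 0<w))
          (solve 3 (λ z w m → z :+ (:1 :+ m) :* w :- (z :+ w) := m :* w :- :0) refl z w (n · 1#)))

        bait-accepted : A hist (bait z) ≡ true
        bait-accepted = accepts hist (bait z) (≤-reflexive (trans (cong price at-z) (sym (density-item (0<price z) 0<w))))
          (subst (λ x → x + w ≤ 1#) (sym at-z) (≤-trans z+w≤z* z*≤1))

        bait-value : earned hist (attack (suc n) z)
                     ≡ price z * w + earned ((bait z , true) ∷ hist) (attack n (z + w))
        bait-value = earned-accept hist (bait z) (attack n (z + w)) bait-accepted

      -- Each bait earns exactly its price times w, which `potential-step≥` charges to the increase
      -- of the potential; the prizes earn nothing.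
      attack-value : ∀ n z hist → utilization hist ≡ z → z + (n · 1#) * w ≡ z* →
                     potential 0# z + earned hist (attack n z) ≤ B
      attack-value zero z hist at-z to-z* = ≤-reflexive (begin
        potential 0# z + earned hist (replicate N prize)
          ≡⟨ cong₂ _+_ (trans (cong (potential 0#) z≡z*) potential-z*) (prizes-value N hist (trans at-z z≡z*)) ⟩
        B + 0#  ≡⟨ +-identityʳ B ⟩
        B       ∎)
        where
        open ≡-Reasoning
        z≡z* : z ≡ z*
        z≡z* = trans (solve 2 (λ z w → z := z :+ :0 :* w) refl z w) to-z*
      attack-value (suc n) z hist at-z to-z* = ≤-trans
        (subst (λ x → potential 0# z + x ≤ potential 0# (z + w) + V′) (sym (bait-value n z hist at-z to-z*))
          (by-≤ (potential-step≥ (<⇒≤ 0<w) (z+w≤z* n z hist at-z to-z*))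
            (solve 4 (λ a b c v → b :+ v :- (a :+ (c :+ v)) := b :- (a :+ c)) refl (potential 0# z) (potential 0# (z + w)) (price z * w) V′)))
        (attack-value n (z + w) ((bait z , true) ∷ hist) (cong (_+ w) at-z)
          (trans (solve 3 (λ z w m → z :+ w :+ m :* w := z :+ (:1 :+ m) :* w) refl z w (n · 1#)) to-z*))
        where
        V′ : ℝ
        V′ = earned ((bait z , true) ∷ hist) (attack n (z + w))

      patient : ∀ n → Decisions (n ℕ.+ N)
      patient zero    = replicate N true
      patient (suc n) = false ∷ patient n

      prizes-total : ∀ n → totalValue (replicate n prize) (replicate n true) ≡ (n · 1#) * (q * w′) ×
                           totalWeight (replicate n prize) (replicate n true) ≡ (n · 1#) * w′
      prizes-total zero    = sym (*-zeroˡ _) , sym (*-zeroˡ _)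
      prizes-total (suc n) =
        trans (cong (q * w′ +_) (proj₁ (prizes-total n)))
            (solve 2 (λ x m → x :+ m :* x := (:1 :+ m) :* x) refl (q * w′) (n · 1#)) ,
        trans (cong (w′ +_) (proj₂ (prizes-total n))) (solve 2 (λ x m → x :+ m :* x := (:1 :+ m) :* x) refl w′ (n · 1#))

      ν*w′≡1 : ν * w′ ≡ 1#
      ν*w′≡1 = *-/-cancel 1# 0<ν

      patient-value : ∀ n z → totalValue (attack n z) (patient n) ≡ q
      patient-value zero z = trans (proj₁ (prizes-total N))
        (trans (solve 3 (λ m q w → m :* (q :* w) := q :* (m :* w)) refl ν q w′)
            (trans (cong (q *_) ν*w′≡1) (solve 1 (λ q → q :* :1 := q) refl q)))
      patient-value (suc n) z = trans (+-identityˡ _) (patient-value n (z + w))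

      patient-weight : ∀ n z → totalWeight (attack n z) (patient n) ≡ 1#
      patient-weight zero    z = trans (proj₂ (prizes-total N)) ν*w′≡1
      patient-weight (suc n) z = trans (+-identityˡ _) (patient-weight n (z + w))

      nonempty : ∀ n → 0# < n · 1# → Σ[ m ∈ ℕ ] n ℕ.+ N ≡ suc m
      nonempty zero    0<0 = ⊥-elim (<-irrefl 0<0)
      nonempty (suc n) _   = n ℕ.+ N , refl

      attack-earns : ∀ n z hist → 0# < n · 1# → utilization hist ≡ z → z + (n · 1#) * w ≡ z* →
          0# < earned hist (attack n z)
      attack-earns zero    _ _    0<0 _    _     = ⊥-elim (<-irrefl 0<0)
      attack-earns (suc n) z hist _   at-z to-z* = subst (0# <_) (sym (bait-value n z hist at-z to-z*))
        (+-pos (*-pos (0<price z) 0<w) (earned-nonneg _ (attack n (z + w))))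

      module _ {δ : ℝ} (1≤ν*δ : 1# ≤ ν * δ) where

        admits-item : ∀ {d x} (0<d : 0# < d) (0<x : 0# < x) → L ≤ d → d ≤ U → x ≤ δ → Admissible δ (item d x 0<d 0<x)
        admits-item 0<d 0<x L≤d d≤U x≤δ =
          subst (L ≤_) (sym (density-item 0<d 0<x)) L≤d , subst (_≤ U) (sym (density-item 0<d 0<x)) d≤U , x≤δ

        prizes-admissible : ∀ n → All (Admissible δ) (replicate n prize)
        prizes-admissible zero    = []
        prizes-admissible (suc n) = admits-item 0<q 0<w′ L≤q (<⇒≤ q<U) (≤*⇒/≤ 0<ν 1≤ν*δ) ∷ prizes-admissible n

        attack-admissible : ∀ n z → All (Admissible δ) (attack n z)
        attack-admissible zero    z = prizes-admissible N
        attack-admissible (suc n) z = admits-item (0<price z) 0<w (L≤price z) (price≤U z) (≤*⇒/≤ 0<ν (≤-trans z*≤1 1≤ν*δ))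
                                      ∷ attack-admissible n (z + w)

        attack-ratio : Σ[ r ∈ ℝ ] (PerformanceRatio A δ r × q / B ≤ r)
        attack-ratio = ratio-from (proj₂ (nonempty N 0<ν)) (attack N 0#) (attack-admissible N 0#) (patient N)
          (≤-reflexive (patient-weight N 0#)) (≤-reflexive
              (sym (patient-value N 0#))) (attack-earns N 0# [] 0<ν refl to-z*) V≤B
          where
          to-z* : 0# + ν * w ≡ z*
          to-z* = trans (+-identityˡ _) (*-/-cancel z* 0<ν)
          V≤B : earned [] (attack N 0#) ≤ B
          V≤B = subst (_≤ B) (trans (cong (_+ earned [] (attack N 0#)) (potential-0 0#)) (+-identityˡ _)) (attack-value N 0# [] refl to-z*)

    ratio≥ : ∀ {ε δ} → 0# < ε → 0# < δ → Σ[ r ∈ ℝ ] (PerformanceRatio (OKP-Alg α) δ r × c - ε < r)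
    ratio≥ {ε} {δ} 0<ε 0<δ = proj₁ ratio , proj₁ (proj₂ ratio) , <-≤-trans c-ε<q/B (proj₂ (proj₂ ratio))
      where
      room t q : ℝ
      -- t < U - L keeps q ≥ L, and t < ε B gives q / B > U / B - ε = c - ε.
      room = min (U - L) (ε * B)
      t    = ½ * room
      q    = U - t
      0<room : 0# < room
      0<room = min-pos (<⇒0<- L<U) (*-pos 0<ε 0<B)
      t<room : t < room
      t<room = ½*-< 0<room
      L≤q : L ≤ q
      L≤q = by-≤ (≤-trans (<⇒≤ t<room) (min-≤ˡ _ _)) (solve 3 (λ l u t → u :- t :- l := u :- l :- t) refl L U t)
      q<U : q < U
      q<U = by-< (*-pos 0<½ 0<room) (solve 2 (λ u t → u :- (u :- t) := t :- :0) refl U t)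
      c-ε<q/B : c - ε < q / B
      c-ε<q/B = ≰⇒> λ q/B≤ → <⇒≱ (<-≤-trans t<room (min-≤ʳ _ _))
        (by-≤ (<⇒≤ 0<B ⊛ q/B≤) (trans
          (solve 5 (λ b c e u t → t :- e :* b := (b :* (c :- e) :- (u :- t)) :+ (u :- c :* b)) refl B c ε U t)
          (trans (cong₂ (λ x y → (B * (c - ε) - x) + (U - y)) (sym (*-/-cancel q 0<B)) c*B≡U)
            (solve 2 (λ x u → x :+ (u :- u) := x) refl (B * (c - ε) - B * (q / B)) U))))
      k : ℕ
      k = proj₁ (archimedean (δ ⁻¹))
      1≤ν*δ : 1# ≤ (suc k · 1#) * δ
      1≤ν*δ = subst₂ _≤_ (inverse 0<δ) (*-comm δ _) (<⇒≤ 0<δ ⊛ ≤-trans (proj₂ (archimedean (δ ⁻¹))) (<⇒≤ (<-suc· k)))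
      ratio : Σ[ r ∈ ℝ ] (PerformanceRatio (OKP-Alg α) δ r × q / B ≤ r)
      ratio = Adversary.attack-ratio (OKP-Alg α) accepts rejects-cheap rejects-overweight (suc k) (·-suc-pos k) q L≤q q<U 1≤ν*δ

    -- The competitive ratio as a limit.

    competitiveRatio : IsCompetitiveRatio (OKP-Alg α) c
    competitiveRatio ε 0<ε = δ₀ , min-pos 0<κ (min-pos (<⇒0<- T<1) (/-pos 0<ε 0<s)) , λ δ 0<δ δ<δ₀ → at δ 0<δ δ<δ₀
      where
      0<LT : 0# < L * T
      0<LT = *-pos 0<L 0<T
      s δ₀ : ℝ
      s = c * (U + U) / (L * T)
      -- The bound κ is the hypothesis of `Accounting`, 1 - T leaves room for an item below `T`, and
      -- ε / s makes the error s δ of the upper bound smaller than ε.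
      δ₀ = min κ (min (1# - T) (ε / s))
      0<s : 0# < s
      0<s = /-pos (*-pos 0<c (+-pos 0<U (<⇒≤ 0<U))) 0<LT
      at : ∀ δ → 0# < δ → δ < δ₀ → Σ[ x ∈ ℝ ] (IsSupremum _≤_ (PerformanceRatio (OKP-Alg α) δ) x × Between (c - ε) (c + ε) x)
      at δ 0<δ δ<δ₀ = proj₁ sup , proj₂ sup , <-≤-trans (proj₂ (proj₂ low)) (proj₁ (proj₂ sup) _ (proj₁ (proj₂ low))) ,
          ≤-<-trans (proj₂ (proj₂ sup) _ upper) small
        where
        Ratios : ℝ → Set
        Ratios = PerformanceRatio (OKP-Alg α) δ
        δ≤κ : δ ≤ κ
        δ≤κ = ≤-trans (<⇒≤ δ<δ₀) (min-≤ˡ _ _)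
        δ<min : δ < min (1# - T) (ε / s)
        δ<min = <-≤-trans δ<δ₀ (min-≤ʳ _ _)
        fits : T + δ ≤ 1#
        fits = by-≤ (≤-trans (<⇒≤ δ<min) (min-≤ˡ _ _)) (solve 2 (λ t d → :1 :- (t :+ d) := :1 :- t :- d) refl T δ)
        low : Σ[ r ∈ ℝ ] (Ratios r × c - ε < r)
        low = ratio≥ 0<ε 0<δ
        upper : IsUpperBound _≤_ Ratios (c + slack δ / (L * T))
        upper _ (n , is , oks , o , isOptimum , refl) =
          Accounting.ratio≤ (OKP-Alg α) decision-justified δ δ≤κ 0<δ fits is oks isOptimum
        sup : Σ[ x ∈ ℝ ] IsSupremum _≤_ Ratios x
        sup = supremum Ratios (proj₁ low , proj₁ (proj₂ low)) (_ , upper)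
        small : c + slack δ / (L * T) < c + ε
        small = by-< (0<s ⊛< <-≤-trans δ<min (min-≤ʳ _ _)) (trans
          (solve 6 (λ c u d i e x → c :+ e :- (c :+ c :* (u :* d) :* i) := e :- c :* u :* i :* d) refl c (U + U) δ ((L * T) ⁻¹) ε s)
          (cong (λ x → x - s * δ) (sym (*-/-cancel ε 0<s))))

-- Uniqueness of the competitive ratio, and the conclusion.

-- For one small δ both limits are close to suprema of the same set of ratios; with e half the gap
-- this excludes b < a. Applied both ways, it makes the competitive ratio unique.
competitiveRatio-≤ : ∀ R E L U → let open Knapsack R E L U in
  ∀ A {a b} → IsCompetitiveRatio A a → IsCompetitiveRatio A b → CompleteOrderedField._≤_ R a b
competitiveRatio-≤ R E L U A {a} {b} ratioA ratioB = ≮⇒≥ absurd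
  where
  open OrderedField R
  open Limits R
  open Knapsack R E L U
  absurd : ¬ b < a
  absurd b<a = <-irrefl (subst (_< b + e) (midpoint a b) (<-trans (proj₁ (proj₂ (proj₂ supA)))
      (≤-<-trans (proj₂ (proj₁ (proj₂ supA)) _ (proj₁ (proj₁ (proj₂ supB)))) (proj₂ (proj₂ (proj₂ supB))))))
    where
    e : ℝ
    e = ½ * (a - b)
    0<e : 0# < e
    0<e = *-pos 0<½ (<⇒0<- b<a)
    δA δB δ : ℝ
    δA = proj₁ (ratioA e 0<e)
    δB = proj₁ (ratioB e 0<e)
    δ  = ½ * min δA δB
    0<min : 0# < min δA δB
    0<min = min-pos (proj₁ (proj₂ (ratioA e 0<e))) (proj₁ (proj₂ (ratioB e 0<e)))
    supA = proj₂ (proj₂ (ratioA e 0<e)) δ (*-pos 0<½ 0<min) (<-≤-trans (½*-< 0<min) (min-≤ˡ δA δB))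
    supB = proj₂ (proj₂ (ratioB e 0<e)) δ (*-pos 0<½ 0<min) (<-≤-trans (½*-< 0<min) (min-≤ʳ δA δB))

theorem3p1 : (R : CompleteOrderedField) (E : ExpLog R) →
    let open CompleteOrderedField R in
    (L U : ℝ) → 0# < L → L < U →
    let open Knapsack R E L U in
    (α : ℝ) → 0# < α →
    IsDegradationFactor (OKP-Alg α) (OKP-Alg 1#) (degradationFormula α) ×
    (∀ cα c₁ → IsCompetitiveRatio (OKP-Alg α) cα →
    IsCompetitiveRatio (OKP-Alg 1#) c₁ →
    cα ≡ degradationFormula α * c₁)
theorem3p1 R E L U 0<L L<U α 0<α =
  (D / T , D₁ / T , ratio-α , ratio-1 , ≤-reflexive scaled ,
    λ f D/T≤ → *-cancelˡ-≤ (/-pos 0<D₁ 0<T) (subst₂ _≤_ (trans scaled (*-comm D (D₁ / T))) (*-comm f (D₁ / T)) D/T≤)) ,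
  λ cα c₁ Cα C₁ → trans (unique (OKP-Alg α) Cα ratio-α) (trans scaled (cong (D *_) (unique (OKP-Alg 1#) ratio-1 C₁)))
  where
  open OrderedField R
  open Knapsack R E L U
  open Parameters R E L U 0<L L<U

  D D₁ : ℝ
  D  = degradationFormula α
  D₁ = degradationFormula 1#

  -- At α = 1 the formula is γ / γ, so the baseline ratio D₁ / T is 1 / T = ln γ + 1.
  D₁≡1 : D₁ ≡ 1#
  D₁≡1 = trans (degradation-if (dec-true (1# ≤? 1#) ≤-refl)) (/-unique
    (subst (0# <_) (sym 1+γ-1≡γ) 0<γ) (solve 1 (λ g → (:1 :+ g :- :1) :* :1 := :1 :* g) refl γ))
    where
    1+γ-1≡γ : 1# + γ - 1# ≡ γ
    1+γ-1≡γ = solve 1 (λ g → :1 :+ g :- :1 := g) refl γ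

  0<D₁ : 0# < D₁
  0<D₁ = <-≤-trans 0<1 (Strategy.1≤D 1# 0<1)

  scaled : D / T ≡ D * (D₁ / T)
  scaled = trans (solve 2 (λ d t → d :* t := d :* (:1 :* t)) refl D (T ⁻¹)) (cong (λ x → D * (x / T)) (sym D₁≡1))

  ratio-α : IsCompetitiveRatio (OKP-Alg α) (D / T)
  ratio-α = Strategy.competitiveRatio α 0<α

  ratio-1 : IsCompetitiveRatio (OKP-Alg 1#) (D₁ / T)
  ratio-1 = Strategy.competitiveRatio 1# 0<1

  unique : ∀ A {a b} → IsCompetitiveRatio A a → IsCompetitiveRatio A b → a ≡ b
  unique A ratio ratio′ = ≤-antisym (competitiveRatio-≤ R E L U A ratio ratio′) (competitiveRatio-≤ R E L U A ratio′ ratio)
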